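{- For all $n\ge 1$, $$\sum_{\lambda\vdash n}(-1)^{e(\lambda)}I_\lambda^2=0,$$ where the sum ranges over all partitions $\lambda$ of $n$, $e(\lambda)=\lambda_2+\lambda_4+\cdots$ is the sum of all even-indexed parts of $\lambda$, and $I_\lambda$ is the imbalance of $\lambda$.
   Context: A standard Young tableau (tableau for short) of shape $\lambda\vdash n$ is a filling of the Young diagram of $\lambda$ (English convention: rows indexed $1,2,\ldots$ from top to bottom, row $i$ having $\lambda_i$ squares, left-justified) with the numbers $1,\ldots,n$, each used once, such that rows increase from left to right and columns increase from top to bottom. Partitions are written $\lambda=(\lambda_1,\lambda_2,\ldots,\lambda_l)$ with $\lambda_1\ge\lambda_2\ge\cdots\ge\lambda_l>0$. For a tableau $T$, a pair $(i,j)$ of entries is an inversion of $T$ if $j<i$ and $j$ is contained in a row below the row of $i$; $\mathrm{inv}(T)$ denotes the number of inversions of $T$. The imbalance of $\lambda$ is $$I_\lambda=\sum_T(-1)^{\mathrm{inv}(T)},$$ where $T$ ranges over all standard Young tableaux of shape $\lambda$.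
   Formalization: The identity is stated for n ≥ 2 instead of n ≥ 1, because at n = 1 the only partition is (1), with e = 0 and imbalance 1, so the sum equals 1 and not 0. -}

module Defs where

open import Data.Integer.Base as ℤ using (ℤ; 0ℤ; 1ℤ; -1ℤ)
open import Data.List.Base
  using (List; []; _∷_; [_]; _++_; map; concat; concatMap; filter; foldr; length; zip;
         upTo; applyUpTo; cartesianProduct; cartesianProductWith)
open import Data.List.Membership.Propositional using (_∈_)
open import Data.List.Membership.Propositional.Properties
  using (∈-filter⁺; ∈-filter⁻; ∈-concat⁺′; ∈-map⁺; ∈-upTo⁺; ∈-applyUpTo⁺; ∈-∃++;
         ∈-cartesianProductWith⁺; ∈-cartesianProductWith⁻)
open import Data.List.Membership.DecPropositional using (_∈?_)
open import Data.List.Properties using (∷-injective; ≡-dec)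
open import Data.List.Relation.Binary.Permutation.Propositional
  using (_↭_; ↭-refl; ↭-sym; ↭-trans; prep)
open import Data.List.Relation.Binary.Permutation.Propositional.Properties
  using (drop-∷; shift; ∈-resp-↭; ¬x∷xs↭[])
open import Data.List.Relation.Unary.All as All using (All; []; _∷_; all?)
import Data.List.Relation.Unary.All.Properties as All
open import Data.List.Relation.Unary.AllPairs using ([]; _∷_)
import Data.List.Relation.Unary.AllPairs.Properties as AllPairs
open import Data.List.Relation.Unary.Any using (here)
open import Data.List.Relation.Unary.Linked using (Linked; linked?)
open import Data.List.Relation.Unary.Unique.Propositional using (Unique)
import Data.List.Relation.Unary.Unique.Propositional.Properties as Unique
open import Data.Nat.Base using (ℕ; zero; suc; _+_; _≤_; _<_; _≥_; z≤n; s≤s)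
open import Data.Nat.ListAction using (sum)
open import Data.Nat.Properties
  using (_≟_; _<?_; _≥?_; ≤-trans; ≤-reflexive; m≤m+n; m≤n+m; +-mono-≤; suc-injective; <⇒≢)
open import Data.Product.Base using (_×_; _,_; proj₁; proj₂; uncurry)
open import Function.Base using (_∘_)
open import Function.Bundles using (_⇔_; mk⇔)
open import Relation.Binary.PropositionalEquality using (_≡_; refl; sym; trans; cong; subst)
open import Relation.Nullary using (Dec; yes; no)
open import Relation.Nullary.Decidable using (_×-dec_; map′)

sumOver : ∀ {a} {A : Set a} → List A → (A → ℤ) → ℤ
sumOver xs f = foldr ℤ._+_ 0ℤ (map f xs)

[1⋯_] : ℕ → List ℕ
[1⋯ n ] = applyUpTo suc n

infix 4 _⊢_

record _⊢_ (μ : List ℕ) (n : ℕ) : Set where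
  constructor mk⊢
  field
    decreasing : Linked _≥_ μ
    positive   : All (0 <_) μ
    total      : sum μ ≡ n

-- μ₂ + μ₄ + ⋯, with parts indexed from 1.
e : List ℕ → ℕ
e []          = 0
e (_ ∷ [])    = 0
e (_ ∷ b ∷ μ) = b + e μ

-- Rows are left-justified and zip truncates to the shorter list, so for
-- consecutive rows this compares exactly the vertically adjacent cells.
_Above_ : List ℕ → List ℕ → Set
r Above s = All (uncurry _<_) (zip r s)

-- T is the list of rows from top to bottom.
record IsSYT (μ : List ℕ) (T : List (List ℕ)) : Set where
  constructor mkSYT
  field
    shape   : map length T ≡ μ
    entries : concat T ↭ [1⋯ sum μ ]
    rows    : All (Linked _<_) T
    columns : Linked _Above_ T

-- The pairs (i , j) with j < i and j in a row below that of i, listed by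
-- the row of i.
inversions : List (List ℕ) → List (ℕ × ℕ)
inversions []      = []
inversions (r ∷ T) =
  filter (λ (i , j) → j <? i) (cartesianProduct r (concat T)) ++ inversions T

inv : List (List ℕ) → ℕ
inv T = length (inversions T)

_↭?_ : (xs ys : List ℕ) → Dec (xs ↭ ys)
[]       ↭? []       = yes ↭-refl
[]       ↭? (y ∷ ys) = no (¬x∷xs↭[] ∘ ↭-sym)
(x ∷ xs) ↭? ys with _∈?_ _≟_ x ys
... | no  x∉ys = no λ p → x∉ys (∈-resp-↭ p (here refl))
... | yes x∈ys with as , bs , refl ← ∈-∃++ x∈ys =
  map′ (λ p → ↭-trans (prep x p) (↭-sym (shift x as bs)))
       (λ p → drop-∷ (↭-trans p (shift x as bs)))
       (xs ↭? (as ++ bs))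

_⊢?_ : ∀ μ n → Dec (μ ⊢ n)
μ ⊢? n = map′ (λ (d , p , t) → mk⊢ d p t) (λ (mk⊢ d p t) → d , p , t)
  (linked? _≥?_ μ ×-dec all? (0 <?_) μ ×-dec sum μ ≟ n)

isSYT? : ∀ μ T → Dec (IsSYT μ T)
isSYT? μ T = map′ (λ (s , e , r , c) → mkSYT s e r c) (λ (mkSYT s e r c) → s , e , r , c)
  (≡-dec _≟_ (map length T) μ
    ×-dec concat T ↭? [1⋯ sum μ ]
    ×-dec all? (linked? _<?_) T
    ×-dec linked? (λ r s → all? (λ (a , b) → a <? b) (zip r s)) T)

-- partitions and tableaux filter a larger finite list; see ∈-partitions,
-- partitions-unique, ∈-tableaux and tableaux-unique for correctness.
words : List ℕ → ℕ → List (List ℕ)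
words xs zero    = [ [] ]
words xs (suc k) = cartesianProductWith _∷_ xs (words xs k)

fillings : List ℕ → List ℕ → List (List (List ℕ))
fillings xs []      = [ [] ]
fillings xs (k ∷ μ) = cartesianProductWith _∷_ (words xs k) (fillings xs μ)

shortWords : ℕ → List (List ℕ)
shortWords n = concatMap (words [1⋯ n ]) (upTo (suc n))

partitions : ℕ → List (List ℕ)
partitions n = filter (_⊢? n) (shortWords n)

tableaux : List ℕ → List (List (List ℕ))
tableaux μ = filter (isSYT? μ) (fillings [1⋯ sum μ ] μ)

imbalance : List ℕ → ℤ
imbalance μ = sumOver (tableaux μ) λ T → -1ℤ ℤ.^ inv T

private
  [1⋯]! : ∀ n → Unique [1⋯ n ]
  [1⋯]! n = Unique.applyUpTo⁺₁ suc n (λ i<j _ eq → <⇒≢ i<j (suc-injective eq))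

  words⁺ : ∀ {xs w} → All (_∈ xs) w → w ∈ words xs (length w)
  words⁺ []       = here refl
  words⁺ (p ∷ ps) = ∈-cartesianProductWith⁺ _∷_ p (words⁺ ps)

  words-length : ∀ xs k {w} → w ∈ words xs k → length w ≡ k
  words-length xs zero    (here refl) = refl
  words-length xs (suc k) p
    with _ , _ , _ , q , refl ← ∈-cartesianProductWith⁻ _∷_ xs (words xs k) p
    = cong suc (words-length xs k q)

  words! : ∀ {xs} k → Unique xs → Unique (words xs k)
  words! zero    xs! = [] ∷ []
  words! (suc k) xs! = Unique.cartesianProductWith⁺ _∷_ ∷-injective xs! (words! k xs!)

  fillings⁺ : ∀ {xs} T → All (_∈ xs) (concat T) → T ∈ fillings xs (map length T)
  fillings⁺ []      _  = here refl
  fillings⁺ (r ∷ T) ps = ∈-cartesianProductWith⁺ _∷_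
    (words⁺ (All.++⁻ˡ r ps)) (fillings⁺ T (All.++⁻ʳ r ps))

  fillings! : ∀ {xs} μ → Unique xs → Unique (fillings xs μ)
  fillings! []      xs! = [] ∷ []
  fillings! (k ∷ μ) xs! =
    Unique.cartesianProductWith⁺ _∷_ ∷-injective (words! k xs!) (fillings! μ xs!)

  length≤sum : ∀ {μ} → All (0 <_) μ → length μ ≤ sum μ
  length≤sum []       = z≤n
  length≤sum (p ∷ ps) = +-mono-≤ p (length≤sum ps)

  parts∈ : ∀ {μ n} → All (0 <_) μ → sum μ ≤ n → All (_∈ [1⋯ n ]) μ
  parts∈ []                      _ = []
  parts∈ {suc a ∷ μ} (s≤s _ ∷ ps) h =
    ∈-applyUpTo⁺ suc (≤-trans (m≤m+n (suc a) (sum μ)) h)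
    ∷ parts∈ ps (≤-trans (m≤n+m (sum μ) (suc a)) h)

∈-partitions : ∀ {μ n} → μ ∈ partitions n ⇔ μ ⊢ n
∈-partitions {μ} {n} = mk⇔ (proj₂ ∘ ∈-filter⁻ (_⊢? n) {xs = shortWords n}) from
  where
  from : μ ⊢ n → μ ∈ partitions n
  from p@(mk⊢ _ pos refl) = ∈-filter⁺ (_⊢? n)
    (∈-concat⁺′ (words⁺ (parts∈ pos (≤-reflexive refl)))
                (∈-map⁺ (words [1⋯ n ]) (∈-upTo⁺ (s≤s (length≤sum pos)))))
    p

partitions-unique : ∀ n → Unique (partitions n)
partitions-unique n = Unique.filter⁺ (_⊢? n) {xs = shortWords n} (Unique.concat⁺
  (All.map⁺ {f = w} (All.universal (λ k → words! k ([1⋯]! n)) (upTo (suc n))))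
  (AllPairs.map⁺ {f = w} (AllPairs.applyUpTo⁺₁ (λ k → k) (suc n) λ {i} {j} i<j _ (p , q) →
    <⇒≢ i<j (trans (sym (words-length [1⋯ n ] i p)) (words-length [1⋯ n ] j q)))))
  where
  w : ℕ → List (List ℕ)
  w = words [1⋯ n ]

∈-tableaux : ∀ {μ T} → T ∈ tableaux μ ⇔ IsSYT μ T
∈-tableaux {μ} {T} = mk⇔ (proj₂ ∘ ∈-filter⁻ (isSYT? μ) {xs = fillings [1⋯ sum μ ] μ}) from
  where
  from : IsSYT μ T → T ∈ tableaux μ
  from p = ∈-filter⁺ (isSYT? μ)
    (subst (λ ν → T ∈ fillings [1⋯ sum μ ] ν) (IsSYT.shape p)
      (fillings⁺ T (All.tabulate (∈-resp-↭ (IsSYT.entries p)))))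
    p

tableaux-unique : ∀ μ → Unique (tableaux μ)
tableaux-unique μ = Unique.filter⁺ (isSYT? μ) (fillings! μ ([1⋯]! (sum μ)))

-- The only partition of 1 is (1), with e = 0 and imbalance 1, so the
-- alternating sum of squared imbalances vanishes only from n = 2 on.
sum-at-1 : sumOver (partitions 1) (λ μ → -1ℤ ℤ.^ e μ ℤ.* imbalance μ ℤ.^ 2) ≡ 1ℤ
sum-at-1 = refl

{-# OPTIONS --safe #-}
module Submission where

-- Removing the entry n from a tableau of shape λ gives the branching rule
-- I = U I, where (U f)(λ) sums ± f(μ) over the shapes μ obtained from λ by
-- deleting a corner, the sign being the parity of the number of cells in lower
-- rows. For the form ⟨λ, λ⟩ = (-1)^{e(λ)} the adjoint of U is the operator D
-- that adds a cell, with an extra sign (-1)^{i-1} for row i. Adding in row i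
-- and removing from row j ≠ i anticommute, and the addable row i + 1 cancels
-- the removable row i, which leaves only the addable first row: DU + UD = 1.
-- Hence D I = c_n I on partitions of n with c_0 = 1 and c_{n+1} = 1 - c_n, and
-- the alternating sum S_{n+1} = ⟨U I, I⟩ = ⟨I, D I⟩ = c_n S_n vanishes from
-- c_1 = 0 on.

open import Defs
open import Algebra.Bundles using (CommutativeMonoid)
open import Data.Bool.Base using (true; false)
open import Data.Integer.Base using (ℤ; 0ℤ; 1ℤ; -1ℤ; _*_; _^_; _+_; _-_; -_)
import Data.Integer.Properties as ℤ
open import Data.Integer.Tactic.RingSolver using (solve-∀)
open import Data.List.Base
  using (List; []; _∷_; [_]; _++_; _∷ʳ_; map; concat; concatMap; filter; length; cartesianProduct)
open import Data.List.Membership.Propositional using (_∈_; find; lose)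
open import Data.List.Membership.Propositional.Properties
  using (∈-∃++; ∈-++⁻; ∈-concatMap⁺; ∈-concatMap⁻)
open import Data.List.Properties
  using (∷-injective; ∷ʳ-injective; ≡-dec; ++-assoc; length-++; applyUpTo-∷ʳ;
         filter-++; filter-all; filter-reject)
import Data.List.Relation.Binary.Permutation.Setoid.Properties as Permutationₛ
open import Data.List.Relation.Binary.Permutation.Propositional
  using (_↭_; ↭-refl; ↭-sym; ↭-trans; ↭-reflexive; prep; ↭⇒↭ₛ)
open import Data.List.Relation.Binary.Permutation.Propositional.Properties
  using (drop-∷; shift; ∈-resp-↭; All-resp-↭; ↭-length; filter-↭; map⁺; ++⁺ˡ; ∷↭∷ʳ)
open import Data.List.Relation.Unary.All as All using (All; []; _∷_)
import Data.List.Relation.Unary.All.Properties as All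
open import Data.List.Relation.Unary.AllPairs as AllPairs using ([]; _∷_)
import Data.List.Relation.Unary.AllPairs.Properties as AllPairs
open import Data.List.Relation.Unary.Any using (here; there)
open import Data.List.Relation.Unary.Linked as Linked using (Linked; []; [-]; _∷_)
open import Data.List.Relation.Unary.Unique.Propositional using (Unique)
import Data.List.Relation.Unary.Unique.Propositional.Properties as Unique
open import Data.Nat.Base as ℕ using (ℕ; zero; suc; _≤_; _<_; _≥_; z≤n; s≤s)
open import Data.Nat.ListAction using (sum)
open import Data.Nat.Properties as ℕ using (_≟_; _≤?_; _<?_)
open import Data.Product.Base using (_×_; _,_; proj₁; proj₂; ∃-syntax)
open import Data.Sum.Base using (_⊎_; inj₁; inj₂)
open import Function.Base using (_∘_)
open import Function.Bundles using (Equivalence)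
open import Relation.Binary.PropositionalEquality
  using (_≡_; _≢_; refl; sym; trans; cong; cong₂; subst; setoid; module ≡-Reasoning)
open import Relation.Nullary using (Dec; yes; no; ¬_; contradiction)

private
  variable
    A B : Set
    P Q R : Set
    f g : List ℕ → ℤ
    b m x y n : ℕ
    μ κ ρ r C C′ : List ℕ
    S T U V : List (List ℕ)

-- Finite sums

sumOver-cong : ∀ {f g : A → ℤ} xs → (∀ {x} → x ∈ xs → f x ≡ g x) → sumOver xs f ≡ sumOver xs g
sumOver-cong []       _  = refl
sumOver-cong (x ∷ xs) eq = cong₂ _+_ (eq (here refl)) (sumOver-cong xs (eq ∘ there))

sumOver-zero : ∀ (xs : List A) → sumOver xs (λ _ → 0ℤ) ≡ 0ℤ
sumOver-zero []       = refl
sumOver-zero (x ∷ xs) = trans (ℤ.+-identityˡ _) (sumOver-zero xs)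

sumOver-+ : ∀ (f g : A → ℤ) xs → sumOver xs (λ x → f x + g x) ≡ sumOver xs f + sumOver xs g
sumOver-+ f g []       = refl
sumOver-+ f g (x ∷ xs) = trans (cong (f x + g x +_) (sumOver-+ f g xs))
  (interchange (f x) (g x) (sumOver xs f) (sumOver xs g))
  where
  interchange : ∀ a b c d → a + b + (c + d) ≡ a + c + (b + d)
  interchange = solve-∀

sumOver-*ˡ : ∀ c (f : A → ℤ) xs → sumOver xs (λ x → c * f x) ≡ c * sumOver xs f
sumOver-*ˡ c f []       = sym (ℤ.*-zeroʳ c)
sumOver-*ˡ c f (x ∷ xs) =
  trans (cong (c * f x +_) (sumOver-*ˡ c f xs)) (sym (ℤ.*-distribˡ-+ c (f x) _))

sumOver-swap : ∀ (f : A → B → ℤ) xs ys →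
  sumOver xs (λ x → sumOver ys (f x)) ≡ sumOver ys (λ y → sumOver xs (λ x → f x y))
sumOver-swap f []       ys = sym (sumOver-zero ys)
sumOver-swap f (x ∷ xs) ys =
  trans (cong (sumOver ys (f x) +_) (sumOver-swap f xs ys)) (sym (sumOver-+ (f x) _ ys))

sumOver-++ : ∀ (f : A → ℤ) xs ys → sumOver (xs ++ ys) f ≡ sumOver xs f + sumOver ys f
sumOver-++ f []       ys = sym (ℤ.+-identityˡ _)
sumOver-++ f (x ∷ xs) ys =
  trans (cong (f x +_) (sumOver-++ f xs ys)) (sym (ℤ.+-assoc (f x) (sumOver xs f) (sumOver ys f)))

sumOver-concatMap : ∀ (f : B → ℤ) (h : A → List B) xs →
  sumOver (concatMap h xs) f ≡ sumOver xs (λ x → sumOver (h x) f)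
sumOver-concatMap f h []       = refl
sumOver-concatMap f h (x ∷ xs) =
  trans (sumOver-++ f (h x) (concatMap h xs)) (cong (sumOver (h x) f +_) (sumOver-concatMap f h xs))

sumOver-↭ : ∀ (f : A → ℤ) {xs ys} → xs ↭ ys → sumOver xs f ≡ sumOver ys f
sumOver-↭ f p = Permutationₛ.foldr-commMonoid (setoid ℤ)
  (CommutativeMonoid.isCommutativeMonoid ℤ.+-0-commutativeMonoid) (↭⇒↭ₛ (map⁺ f p))

-- A partial bijection suffices: the partner of each `x` is split off `ys` up to permutation, and
-- whatever remains unmatched has value 0. This form lets the tableaux of one shape be compared with
-- all tableaux having one entry fewer.
sumOver-matching : ∀ (_~_ : A → B → Set) (f : A → ℤ) (g : B → ℤ) {xs ys} →
  (∀ {x y y′} → x ~ y → x ~ y′ → y ≡ y′) → (∀ {x x′ y} → x ~ y → x′ ~ y → x ≡ x′) →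
  (∀ {x y} → x ~ y → f x ≡ g y) →
  Unique xs → Unique ys →
  (∀ {x} → x ∈ xs → ∃[ y ] y ∈ ys × x ~ y) →
  (∀ {y} → y ∈ ys → g y ≡ 0ℤ ⊎ ∃[ x ] x ∈ xs × x ~ y) →
  sumOver xs f ≡ sumOver ys g
sumOver-matching _~_ f g {[]} {ys} fun inj val _ _ tot cov =
  sym (trans (sumOver-cong ys zero-at) (sumOver-zero ys))
  where
  zero-at : ∀ {y} → y ∈ ys → g y ≡ 0ℤ
  zero-at y∈ with cov y∈
  ... | inj₁ gy≡0        = gy≡0
  ... | inj₂ (_ , () , _)
sumOver-matching _~_ f g {x ∷ xs} fun inj val (x∉xs ∷ xs!) ys! tot cov
  with y , y∈ , x~y ← tot (here refl)
  with as , bs , refl ← ∈-∃++ y∈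
  with y∉ ∷ rest! ← Permutationₛ.Unique-resp-↭ (setoid _) (↭⇒↭ₛ (shift y as bs)) ys!
  = trans (cong₂ _+_ (val x~y) (sumOver-matching _~_ f g fun inj val xs! rest! tot′ cov′))
          (sym (sumOver-↭ g (shift y as bs)))
  where
  tot′ : ∀ {x′} → x′ ∈ xs → ∃[ y′ ] y′ ∈ as ++ bs × x′ ~ y′
  tot′ x′∈ with tot (there x′∈)
  ... | y′ , y′∈ , x′~y′ with ∈-resp-↭ (shift y as bs) y′∈
  -- The partner of a later `x′` cannot be the `y` just split off, since `x` would then recur in the
  -- tail.
  ...   | here refl  = contradiction (inj x~y x′~y′) (All.lookup x∉xs x′∈)
  ...   | there y′∈′ = y′ , y′∈′ , x′~y′
  cov′ : ∀ {y′} → y′ ∈ as ++ bs → g y′ ≡ 0ℤ ⊎ ∃[ x′ ] x′ ∈ xs × x′ ~ y′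
  cov′ y′∈ with cov (∈-resp-↭ (↭-sym (shift y as bs)) (there y′∈))
  ... | inj₁ gy≡0                     = inj₁ gy≡0
  ... | inj₂ (x′ , there x′∈ , x′~y′) = inj₂ (x′ , x′∈ , x′~y′)
  ... | inj₂ (x′ , here refl , x′~y′) = contradiction (fun x~y x′~y′) (All.lookup y∉ y′∈)

-- Signs and indicators

sgn : ℕ → ℤ
sgn k = -1ℤ ^ k

sgn-suc : ∀ k → sgn (suc k) ≡ - sgn k
sgn-suc k = ℤ.-1*i≡-i (sgn k)

sgn-+ : ∀ j k → sgn (j ℕ.+ k) ≡ sgn j * sgn k
sgn-+ = ℤ.^-distribˡ-+-* -1ℤ

sgn² : ∀ k → sgn k * sgn k ≡ 1ℤ
sgn² zero    = refl
sgn² (suc k) rewrite sgn-suc k = trans (neg-square (sgn k)) (sgn² k)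
  where
  neg-square : ∀ s → - s * - s ≡ s * s
  neg-square = solve-∀

-- Conditions on corners become integer coefficients, so that identities between operators reduce to
-- ring identities.
⟦_⟧ : Dec P → ℤ
⟦ yes _ ⟧ = 1ℤ
⟦ no  _ ⟧ = 0ℤ

⟦⟧-true : (p? : Dec P) → P → ⟦ p? ⟧ ≡ 1ℤ
⟦⟧-true (yes _) _ = refl
⟦⟧-true (no ¬p) p = contradiction p ¬p

⟦⟧-false : (p? : Dec P) → ¬ P → ⟦ p? ⟧ ≡ 0ℤ
⟦⟧-false (yes p) ¬p = contradiction p ¬p
⟦⟧-false (no _)  _  = refl

⟦⟧-cong : (p? : Dec P) (q? : Dec Q) → (P → Q) → (Q → P) → ⟦ p? ⟧ ≡ ⟦ q? ⟧
⟦⟧-cong (yes p) q? to from = sym (⟦⟧-true q? (to p))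
⟦⟧-cong (no ¬p) q? to from = sym (⟦⟧-false q? (¬p ∘ from))

⟦⟧*-cong : ∀ (p? : Dec P) {a c} → (P → a ≡ c) → ⟦ p? ⟧ * a ≡ ⟦ p? ⟧ * c
⟦⟧*-cong (yes p) eq = cong (1ℤ *_) (eq p)
⟦⟧*-cong (no _)  eq = refl

⟦⟧-× : (r? : Dec R) (p? : Dec P) (q? : Dec Q) → (R → P × Q) → (P → Q → R) →
  ⟦ r? ⟧ ≡ ⟦ p? ⟧ * ⟦ q? ⟧
⟦⟧-× r? (yes p) (yes q) to from = ⟦⟧-true r? (from p q)
⟦⟧-× r? (yes p) (no ¬q) to from = ⟦⟧-false r? (¬q ∘ proj₂ ∘ to)
⟦⟧-× r? (no ¬p) q?      to from = ⟦⟧-false r? (¬p ∘ proj₁ ∘ to)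

-- With the first argument fixed this is a basis function, so `remove (δ μ) κ` and `add b (δ κ) μ`
-- are the matrix entries of the two operators.
δ : List ℕ → List ℕ → ℤ
δ μ ρ = ⟦ ≡-dec _≟_ μ ρ ⟧

δ-refl : ∀ μ → δ μ μ ≡ 1ℤ
δ-refl μ = ⟦⟧-true (≡-dec _≟_ μ μ) refl

δ-≢ : μ ≢ ρ → δ μ ρ ≡ 0ℤ
δ-≢ {μ} {ρ} = ⟦⟧-false (≡-dec _≟_ μ ρ)

δ-∷ : ∀ x y μ ρ → δ (x ∷ μ) (y ∷ ρ) ≡ ⟦ x ≟ y ⟧ * δ μ ρ
δ-∷ x y μ ρ = ⟦⟧-× (≡-dec _≟_ (x ∷ μ) (y ∷ ρ)) (x ≟ y) (≡-dec _≟_ μ ρ)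
  ∷-injective (λ { refl refl → refl })

sumOver-δ : ∀ {xs} (f : List ℕ → ℤ) → Unique xs → ρ ∈ xs → sumOver xs (λ μ → f μ * δ μ ρ) ≡ f ρ
sumOver-δ {ρ} {_ ∷ xs} f (x∉xs ∷ _) (here refl) = begin
  f ρ * δ ρ ρ + sumOver xs (λ μ → f μ * δ μ ρ)
    ≡⟨ cong₂ _+_ (cong (f ρ *_) (δ-refl ρ)) (sumOver-cong xs λ μ∈ →
         trans (cong (f _ *_) (δ-≢ (All.lookup x∉xs μ∈ ∘ sym))) (ℤ.*-zeroʳ (f _))) ⟩
  f ρ * 1ℤ + sumOver xs (λ _ → 0ℤ)
    ≡⟨ cong₂ _+_ (ℤ.*-identityʳ (f ρ)) (sumOver-zero xs) ⟩
  f ρ + 0ℤ ≡⟨ ℤ.+-identityʳ (f ρ) ⟩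
  f ρ ∎
  where open ≡-Reasoning
sumOver-δ {ρ} {μ ∷ xs} f (x∉xs ∷ xs!) (there ρ∈) = begin
  f μ * δ μ ρ + sumOver xs (λ μ → f μ * δ μ ρ)
    ≡⟨ cong₂ _+_ (cong (f μ *_) (δ-≢ (All.lookup x∉xs ρ∈))) (sumOver-δ f xs! ρ∈) ⟩
  f μ * 0ℤ + f ρ ≡⟨ cong (_+ f ρ) (ℤ.*-zeroʳ (f μ)) ⟩
  0ℤ + f ρ       ≡⟨ ℤ.+-identityˡ (f ρ) ⟩
  f ρ ∎
  where open ≡-Reasoning

-- Partitions

-- Partitions with all parts at most `b`. The index combines monotonicity and positivity, and on
-- passing to the tail the first row becomes the new bound.
data Bounded : ℕ → List ℕ → Set where
  []  : Bounded b []
  _∷_ : suc x ≤ b → Bounded (suc x) μ → Bounded b (suc x ∷ μ)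

top : List ℕ → ℕ
top []      = 0
top (x ∷ _) = x

Bounded-weaken : x ≤ y → Bounded x μ → Bounded y μ
Bounded-weaken x≤y []       = []
Bounded-weaken x≤y (p ∷ ps) = ℕ.≤-trans p x≤y ∷ ps

Bounded-top : top μ ≤ y → Bounded x μ → Bounded y μ
Bounded-top t≤y []       = []
Bounded-top t≤y (_ ∷ ps) = t≤y ∷ ps

Bounded-tail : Bounded b (x ∷ μ) → Bounded x μ
Bounded-tail (_ ∷ ps) = ps

top≤ : Bounded b μ → top μ ≤ b
top≤ []      = z≤n
top≤ (p ∷ _) = p

Bounded-0 : Bounded 0 μ → μ ≡ []
Bounded-0 [] = refl

infixr 5 _∷⁰_

-- Drops an emptied row; in a partition only the last row can become empty.
_∷⁰_ : ℕ → List ℕ → List ℕ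
zero  ∷⁰ μ = μ
suc x ∷⁰ μ = suc x ∷ μ

sum-∷⁰ : ∀ x μ → sum (x ∷⁰ μ) ≡ x ℕ.+ sum μ
sum-∷⁰ zero    μ = refl
sum-∷⁰ (suc x) μ = refl

Bounded-∷⁰ : x ≤ b → Bounded x μ → Bounded b (x ∷⁰ μ)
Bounded-∷⁰ {zero}  x≤b ps = Bounded-weaken z≤n ps
Bounded-∷⁰ {suc x} x≤b ps = x≤b ∷ ps

-- Dropping the first row exchanges odd and even positions, so `e (x ∷ μ)` and `e μ` add up to
-- `sum μ`; the square of `sgn (e μ)` is 1.
sgn-e-∷ : ∀ x μ → sgn (e (x ∷ μ)) ≡ sgn (sum μ) * sgn (e μ)
sgn-e-∷ x μ = begin
  sgn (e (x ∷ μ))                         ≡⟨ ℤ.*-identityʳ _ ⟨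
  sgn (e (x ∷ μ)) * 1ℤ                    ≡⟨ cong (sgn (e (x ∷ μ)) *_) (sgn² (e μ)) ⟨
  sgn (e (x ∷ μ)) * (sgn (e μ) * sgn (e μ)) ≡⟨ ℤ.*-assoc (sgn (e (x ∷ μ))) _ _ ⟨
  sgn (e (x ∷ μ)) * sgn (e μ) * sgn (e μ) ≡⟨ cong (_* sgn (e μ)) (sgn-+ (e (x ∷ μ)) (e μ)) ⟨
  sgn (e (x ∷ μ) ℕ.+ e μ) * sgn (e μ)     ≡⟨ cong (λ k → sgn k * sgn (e μ)) (e-∷ x μ) ⟩
  sgn (sum μ) * sgn (e μ) ∎
  where
  open ≡-Reasoning
  e-∷ : ∀ x μ → e (x ∷ μ) ℕ.+ e μ ≡ sum μ
  e-∷ x []      = refl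
  e-∷ x (y ∷ μ) = trans (ℕ.+-assoc y (e μ) (e (y ∷ μ)))
    (cong (y ℕ.+_) (trans (ℕ.+-comm (e μ) _) (e-∷ y μ)))

-- Removing and adding a corner

-- The operator U, row by row. The indicator tests that the shortened row is still at least as long
-- as the next one, and the size of the tail counts the cells in lower rows.
remove : (List ℕ → ℤ) → List ℕ → ℤ
remove f []          = 0ℤ
remove f (zero ∷ μ)  = 0ℤ
remove f (suc x ∷ μ) =
  ⟦ top μ ≤? x ⟧ * (sgn (sum μ) * f (x ∷⁰ μ)) + remove (λ ρ → f (suc x ∷ ρ)) μ

-- b bounds the length of the new first row. The recursive call on the tail
-- carries the sign (-1)^{i-1} of row i.
add : ℕ → (List ℕ → ℤ) → List ℕ → ℤ
add b f []      = ⟦ 0 <? b ⟧ * f [ 1 ]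
add b f (x ∷ μ) = ⟦ x <? b ⟧ * (sgn (sum μ) * f (suc x ∷ μ)) - add x (λ ρ → f (x ∷ ρ)) μ

-- Illegal removals have coefficient 0, so only values at partitions with one cell fewer matter.
-- Boundedness is offered as an implication so that the recursive call can take the first row as its
-- bound.
remove-cong : ∀ κ → (∀ μ → (Bounded b κ → Bounded b μ) → suc (sum μ) ≡ sum κ → f μ ≡ g μ) →
  remove f κ ≡ remove g κ
remove-cong []          eq = refl
remove-cong (zero ∷ κ)  eq = refl
remove-cong (suc x ∷ κ) eq = cong₂ _+_
  (⟦⟧*-cong (top κ ≤? x) λ t≤x → cong (sgn (sum κ) *_) (eq (x ∷⁰ κ)
    (λ {(p ∷ ps) → Bounded-∷⁰ (ℕ.<⇒≤ p) (Bounded-top t≤x ps)})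
    (cong suc (sum-∷⁰ x κ))))
  (remove-cong κ λ μ bnd size → eq (suc x ∷ μ)
    (λ {(p ∷ ps) → p ∷ bnd ps})
    (trans (sym (ℕ.+-suc (suc x) (sum μ))) (cong (suc x ℕ.+_) size)))

add-cong : ∀ μ → (∀ κ → (Bounded b μ → Bounded b κ) → sum κ ≡ suc (sum μ) → f κ ≡ g κ) →
  add b f μ ≡ add b g μ
add-cong {b} []      eq = ⟦⟧*-cong (0 <? b) λ 0<b → eq [ 1 ] (λ _ → 0<b ∷ []) refl
add-cong {b} (x ∷ μ) eq = cong₂ _-_
  (⟦⟧*-cong (x <? b) λ x<b → cong (sgn (sum μ) *_) (eq (suc x ∷ μ)
    (λ {(p ∷ ps) → x<b ∷ Bounded-weaken (ℕ.n≤1+n _) ps})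
    refl))
  (add-cong μ λ κ bnd size → eq (x ∷ κ)
    (λ {(p ∷ ps) → p ∷ bnd ps})
    (trans (cong (x ℕ.+_) size) (ℕ.+-suc x (sum μ))))

remove-ext : (∀ μ → f μ ≡ g μ) → ∀ κ → remove f κ ≡ remove g κ
remove-ext eq κ = remove-cong {b = 0} κ λ μ _ _ → eq μ

add-ext : (∀ κ → f κ ≡ g κ) → ∀ μ → add b f μ ≡ add b g μ
add-ext eq μ = add-cong μ λ κ _ _ → eq κ

-- Linearity of the two operators

remove-+ : ∀ f g κ → remove (λ μ → f μ + g μ) κ ≡ remove f κ + remove g κ
remove-+ f g []          = refl
remove-+ f g (zero ∷ κ)  = refl
remove-+ f g (suc x ∷ κ) =
  trans (cong (λ q → ⟦ top κ ≤? x ⟧ * (sgn (sum κ) * (f (x ∷⁰ κ) + g (x ∷⁰ κ))) + q)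
      (remove-+ (λ ρ → f (suc x ∷ ρ)) (λ ρ → g (suc x ∷ ρ)) κ))
    (distrib ⟦ top κ ≤? x ⟧ (sgn (sum κ)) (f (x ∷⁰ κ)) (g (x ∷⁰ κ)) _ _)
  where
  distrib : ∀ c s a a′ q r′ →
    c * (s * (a + a′)) + (q + r′) ≡ (c * (s * a) + q) + (c * (s * a′) + r′)
  distrib = solve-∀

remove-* : ∀ c f κ → remove (λ μ → c * f μ) κ ≡ c * remove f κ
remove-* c f []          = sym (ℤ.*-zeroʳ c)
remove-* c f (zero ∷ κ)  = sym (ℤ.*-zeroʳ c)
remove-* c f (suc x ∷ κ) =
  trans (cong (λ q → ⟦ top κ ≤? x ⟧ * (sgn (sum κ) * (c * f (x ∷⁰ κ))) + q)
      (remove-* c (λ ρ → f (suc x ∷ ρ)) κ))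
    (distrib c ⟦ top κ ≤? x ⟧ (sgn (sum κ)) (f (x ∷⁰ κ)) _)
  where
  distrib : ∀ c d s a q → d * (s * (c * a)) + c * q ≡ c * (d * (s * a) + q)
  distrib = solve-∀

add-+ : ∀ b f g μ → add b (λ κ → f κ + g κ) μ ≡ add b f μ + add b g μ
add-+ b f g []      = ℤ.*-distribˡ-+ ⟦ 0 <? b ⟧ _ _
add-+ b f g (x ∷ μ) =
  trans (cong (λ q → ⟦ x <? b ⟧ * (sgn (sum μ) * (f (suc x ∷ μ) + g (suc x ∷ μ))) - q)
      (add-+ x (λ ρ → f (x ∷ ρ)) (λ ρ → g (x ∷ ρ)) μ))
    (distrib ⟦ x <? b ⟧ (sgn (sum μ)) (f (suc x ∷ μ)) (g (suc x ∷ μ)) _ _)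
  where
  distrib : ∀ c s a a′ q r′ →
    c * (s * (a + a′)) - (q + r′) ≡ (c * (s * a) - q) + (c * (s * a′) - r′)
  distrib = solve-∀

add-* : ∀ b c f μ → add b (λ κ → c * f κ) μ ≡ c * add b f μ
add-* b c f []      = swap ⟦ 0 <? b ⟧ c _
  where
  swap : ∀ d c a → d * (c * a) ≡ c * (d * a)
  swap = solve-∀
add-* b c f (x ∷ μ) =
  trans (cong (λ q → ⟦ x <? b ⟧ * (sgn (sum μ) * (c * f (suc x ∷ μ))) - q)
      (add-* x c (λ ρ → f (x ∷ ρ)) μ))
    (distrib c ⟦ x <? b ⟧ (sgn (sum μ)) (f (suc x ∷ μ)) _)
  where
  distrib : ∀ c d s a q → d * (s * (c * a)) - c * q ≡ c * (d * (s * a) - q)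
  distrib = solve-∀

remove-0 : ∀ κ → remove (λ _ → 0ℤ) κ ≡ 0ℤ
remove-0 κ = remove-* 0ℤ (λ _ → 0ℤ) κ

add-0 : ∀ b μ → add b (λ _ → 0ℤ) μ ≡ 0ℤ
add-0 b μ = add-* b 0ℤ (λ _ → 0ℤ) μ

remove-sumOver : ∀ (h : A → List ℕ → ℤ) xs κ →
  remove (λ ρ → sumOver xs (λ x → h x ρ)) κ ≡ sumOver xs (λ x → remove (h x) κ)
remove-sumOver h []       κ = remove-0 κ
remove-sumOver h (x ∷ xs) κ =
  trans (remove-+ (h x) _ κ) (cong (remove (h x) κ +_) (remove-sumOver h xs κ))

add-sumOver : ∀ b (h : A → List ℕ → ℤ) xs μ →
  add b (λ ρ → sumOver xs (λ x → h x ρ)) μ ≡ sumOver xs (λ x → add b (h x) μ)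
add-sumOver b h []       μ = add-0 b μ
add-sumOver b h (x ∷ xs) μ =
  trans (add-+ b (h x) _ μ) (cong (add b (h x) μ +_) (add-sumOver b h xs μ))

remove-δ-∷ : ∀ x y μ κ → remove (λ ρ → δ (x ∷ μ) (y ∷ ρ)) κ ≡ ⟦ x ≟ y ⟧ * remove (δ μ) κ
remove-δ-∷ x y μ κ = trans (remove-ext (δ-∷ x y μ) κ) (remove-* ⟦ x ≟ y ⟧ (δ μ) κ)

add-δ-∷ : ∀ x y κ μ → add b (λ ρ → δ (x ∷ κ) (y ∷ ρ)) μ ≡ ⟦ x ≟ y ⟧ * add b (δ κ) μ
add-δ-∷ {b} x y κ μ = trans (add-ext (δ-∷ x y κ) μ) (add-* b ⟦ x ≟ y ⟧ (δ κ) μ)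

-- Commutation relation

-- Every shape reached has one cell fewer than `κ`, so its parity sign is opposite. Together with
-- `add-sgn` this is the source of anticommutation: changing a lower row flips the sign attached to
-- a row above it.
remove-sgn : ∀ h κ → remove (λ μ → sgn (sum μ) * h μ) κ ≡ - (sgn (sum κ) * remove h κ)
remove-sgn h []          = refl
remove-sgn h (zero ∷ κ)  = cong -_ (sym (ℤ.*-zeroʳ (sgn (sum κ))))
remove-sgn h (suc x ∷ κ) = begin
  c * (s * (sgn (sum (x ∷⁰ κ)) * a)) + remove (λ ρ → sgn (suc x ℕ.+ sum ρ) * h (suc x ∷ ρ)) κ
    ≡⟨ cong₂ _+_ (cong (λ k → c * (s * (k * a))) (trans (cong sgn (sum-∷⁰ x κ)) (sgn-+ x (sum κ))))
         (trans (remove-ext (λ ρ → trans (cong (_* h (suc x ∷ ρ)) (sgn-+ (suc x) (sum ρ)))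
                                         (ℤ.*-assoc (sgn (suc x)) (sgn (sum ρ)) _)) κ)
         (trans (remove-* (sgn (suc x)) (λ ρ → sgn (sum ρ) * h (suc x ∷ ρ)) κ)
                (cong₂ _*_ (sgn-suc x) (remove-sgn (λ ρ → h (suc x ∷ ρ)) κ)))) ⟩
  c * (s * (t * s * a)) + - t * - (s * q)
    ≡⟨ rearrange c s t a q ⟩
  - (- t * s * (c * (s * a) + q))
    ≡⟨ cong (λ k → - (k * (c * (s * a) + q)))
         (trans (cong (_* s) (sym (sgn-suc x))) (sym (sgn-+ (suc x) (sum κ)))) ⟩
  - (sgn (suc x ℕ.+ sum κ) * (c * (s * a) + q)) ∎
  where
  open ≡-Reasoning
  c = ⟦ top κ ≤? x ⟧
  s = sgn (sum κ)
  t = sgn x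
  a = h (x ∷⁰ κ)
  q = remove (λ ρ → h (suc x ∷ ρ)) κ
  rearrange : ∀ c s t a q →
    c * (s * (t * s * a)) + - t * - (s * q) ≡ - (- t * s * (c * (s * a) + q))
  rearrange = solve-∀

add-sgn : ∀ b h μ → add b (λ κ → sgn (sum κ) * h κ) μ ≡ - (sgn (sum μ) * add b h μ)
add-sgn b h []      = neg ⟦ 0 <? b ⟧ (h [ 1 ])
  where
  neg : ∀ c a → c * (- 1ℤ * a) ≡ - (1ℤ * (c * a))
  neg = solve-∀
add-sgn b h (x ∷ μ) = begin
  c * (s * (sgn (suc x ℕ.+ sum μ) * a)) - add x (λ ρ → sgn (x ℕ.+ sum ρ) * h (x ∷ ρ)) μ
    ≡⟨ cong₂ (λ k l → c * (s * (k * a)) - l)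
         (trans (sgn-suc (x ℕ.+ sum μ)) (cong -_ (sgn-+ x (sum μ))))
         (trans (add-ext (λ ρ → trans (cong (_* h (x ∷ ρ)) (sgn-+ x (sum ρ)))
                                      (ℤ.*-assoc t (sgn (sum ρ)) _)) μ)
         (trans (add-* x t (λ ρ → sgn (sum ρ) * h (x ∷ ρ)) μ)
                (cong (t *_) (add-sgn x (λ ρ → h (x ∷ ρ)) μ)))) ⟩
  c * (s * (- (t * s) * a)) - t * - (s * q)
    ≡⟨ rearrange c s t a q ⟩
  - (t * s * (c * (s * a) - q))
    ≡⟨ cong (λ k → - (k * (c * (s * a) - q))) (sym (sgn-+ x (sum μ))) ⟩
  - (sgn (x ℕ.+ sum μ) * (c * (s * a) - q)) ∎
  where
  open ≡-Reasoning
  c = ⟦ x <? b ⟧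
  s = sgn (sum μ)
  t = sgn x
  a = h (suc x ∷ μ)
  q = add x (λ ρ → h (x ∷ ρ)) μ
  rearrange : ∀ c s t a q →
    c * (s * (- (t * s) * a)) - t * - (s * q) ≡ - (t * s * (c * (s * a) - q))
  rearrange = solve-∀

-- Adding a cell under a row of length `suc x` and then shortening that row to `x` is legal exactly
-- when one may first shorten and then add under a row of length `x`.
add-top : ∀ x h μ →
  add (suc x) (λ κ → ⟦ top κ ≤? x ⟧ * h κ) μ ≡ ⟦ top μ ≤? x ⟧ * add x h μ
add-top x h []      = refl
add-top x h (y ∷ μ) = begin
  ⟦ y <? suc x ⟧ * (s * (⟦ suc y ≤? x ⟧ * a)) - add y (λ ρ → ⟦ y ≤? x ⟧ * h (y ∷ ρ)) μ
    ≡⟨ cong₂ _-_ (top-row (y <? suc x) (y ≤? x) (y <? x)) (add-* y ⟦ y ≤? x ⟧ (λ ρ → h (y ∷ ρ)) μ) ⟩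
  ⟦ y ≤? x ⟧ * (⟦ y <? x ⟧ * (s * a)) - ⟦ y ≤? x ⟧ * q
    ≡⟨ factor ⟦ y ≤? x ⟧ _ _ ⟩
  ⟦ y ≤? x ⟧ * (⟦ y <? x ⟧ * (s * a) - q) ∎
  where
  open ≡-Reasoning
  s = sgn (sum μ)
  a = h (suc y ∷ μ)
  q = add y (λ ρ → h (y ∷ ρ)) μ
  factor : ∀ c p q → c * p - c * q ≡ c * (p - q)
  factor = solve-∀
  comm : ∀ c d s a → c * (s * (d * a)) ≡ c * (d * (s * a))
  comm = solve-∀
  top-row : (p? : Dec (y < suc x)) (q? : Dec (y ≤ x)) (r? : Dec (y < x)) →
    ⟦ p? ⟧ * (s * (⟦ r? ⟧ * a)) ≡ ⟦ q? ⟧ * (⟦ r? ⟧ * (s * a))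
  top-row p? q? r? = trans (cong (_* (s * (⟦ r? ⟧ * a))) (⟦⟧-cong p? q? ℕ.s≤s⁻¹ s≤s))
    (comm ⟦ q? ⟧ ⟦ r? ⟧ s a)

-- A first row of length b admits no new cell; otherwise each addable row
-- except the first cancels the removable row above it.
commutation : ∀ f → Bounded b μ →
  add b (remove f) μ + remove (add b f) μ ≡ ⟦ top μ <? b ⟧ * f μ
commutation {b} f [] = unit ⟦ 0 <? b ⟧ (f [])
  where
  unit : ∀ c a → c * (1ℤ * (1ℤ * a) + 0ℤ) + 0ℤ ≡ c * a
  unit = solve-∀
commutation {b} f (_∷_ {x = x} {μ = μ} x<b ps) = begin
  c * (s * (⟦ top μ ≤? suc x ⟧ * (s * a) + q)) - add (suc x) (λ ρ → ⟦ top ρ ≤? x ⟧ * h ρ + remove fₓ ρ) μ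
    + (d * (s * add b f (x ∷⁰ μ))
       + remove (λ ρ → c * (sgn (sum ρ) * f (suc (suc x) ∷ ρ)) - add (suc x) fₓ ρ) μ)
    ≡⟨ cong₂ _+_
         (cong₂ (λ k l → c * (s * (k * (s * a) + q)) - l)
           (⟦⟧-true (top μ ≤? suc x) (top≤ ps)) add-first)
         (cong₂ _+_ (trans (swap d s _) (cong (s *_) (add-removed x x<b ps))) remove-second) ⟩
  -- Here `c` allows the first row to grow and `d` to shrink. The mixed terms, in `q` and in `w`,
  -- each occur twice with opposite signs and cancel.
  c * (s * (1ℤ * (s * a) + q)) - (d * - (s * w) + u) + (s * (d * (s * a - w)) + (c * - (s * q) - v))
    ≡⟨ rearrange c d s a q w u v ⟩
  c * (s * s * a) + d * (s * s * a) - (u + v)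
    ≡⟨ cong₂ (λ k l → c * (k * a) + d * (k * a) - l) (sgn² (sum μ))
         -- By induction the lower rows contribute `d * a`, which cancels the term from shortening
         -- the first row and restoring it.
         (trans (commutation fₓ ps)
                (cong (_* a) (⟦⟧-cong (top μ <? suc x) (top μ ≤? x) ℕ.s≤s⁻¹ s≤s))) ⟩
  c * (1ℤ * a) + d * (1ℤ * a) - d * a
    ≡⟨ cancel c d a ⟩
  c * a ∎
  where
  open ≡-Reasoning
  fₓ h k : List ℕ → ℤ
  fₓ ρ = f (suc x ∷ ρ)
  k ρ = f (x ∷⁰ ρ)
  h ρ = sgn (sum ρ) * k ρ
  c = ⟦ suc x <? b ⟧
  d = ⟦ top μ ≤? x ⟧
  s = sgn (sum μ)
  a = f (suc x ∷ μ)
  q = remove (λ ρ → f (suc (suc x) ∷ ρ)) μ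
  w = add x k μ
  u = add (suc x) (remove fₓ) μ
  v = remove (add (suc x) fₓ) μ

  swap : ∀ d s z → d * (s * z) ≡ s * (d * z)
  swap = solve-∀
  cancel : ∀ c d a → c * (1ℤ * a) + d * (1ℤ * a) - d * a ≡ c * a
  cancel = solve-∀
  rearrange : ∀ c d s a q w u v →
    c * (s * (1ℤ * (s * a) + q)) - (d * - (s * w) + u) + (s * (d * (s * a - w)) + (c * - (s * q) - v))
      ≡ c * (s * s * a) + d * (s * s * a) - (u + v)
  rearrange = solve-∀

  add-first : add (suc x) (λ ρ → ⟦ top ρ ≤? x ⟧ * h ρ + remove fₓ ρ) μ ≡ d * - (s * w) + u
  add-first = trans (add-+ (suc x) _ (remove fₓ) μ)
    (cong (_+ u) (trans (add-top x h μ) (cong (d *_) (add-sgn x k μ))))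

  add-removed : ∀ x → x < b → Bounded (suc x) μ →
    ⟦ top μ ≤? x ⟧ * add b f (x ∷⁰ μ)
      ≡ ⟦ top μ ≤? x ⟧ * (sgn (sum μ) * f (suc x ∷ μ) - add x (λ ρ → f (x ∷⁰ ρ)) μ)
  -- For `x` zero the shortened row disappears. Then `μ` is empty, or it has first part 1 and the
  -- indicator makes both sides 0.
  add-removed zero    x<b []              = cong (1ℤ *_)
    (trans (cong (_* f [ 1 ]) (⟦⟧-true (0 <? b) x<b)) (unit (f [ 1 ])))
    where
    unit : ∀ a → 1ℤ * a ≡ 1ℤ * a - 0ℤ
    unit = solve-∀
  add-removed zero    x<b (s≤s z≤n ∷ _)   = refl
  add-removed (suc x) x<b _               = cong (λ k → ⟦ top μ ≤? suc x ⟧ * (k - _))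
    (trans (cong (_* z) (⟦⟧-true (suc x <? b) x<b)) (ℤ.*-identityˡ z))
    where z = sgn (sum μ) * f (suc (suc x) ∷ μ)

  remove-second : remove (λ ρ → c * (sgn (sum ρ) * f (suc (suc x) ∷ ρ)) - add (suc x) fₓ ρ) μ
    ≡ c * - (s * q) - v
  remove-second = trans (remove-+ _ (λ ρ → - add (suc x) fₓ ρ) μ) (cong₂ _+_
    (trans (remove-* c _ μ) (cong (c *_) (remove-sgn _ μ)))
    (trans (remove-ext (λ ρ → sym (ℤ.-1*i≡-i (add (suc x) fₓ ρ))) μ)
    (trans (remove-* -1ℤ (add (suc x) fₓ) μ) (ℤ.-1*i≡-i v))))

-- Adjointness

-- When the shapes agree, the indicator is implied by the bound on `μ`; otherwise both sides vanish.
-- The emptied row `0 ∷⁰ κ` causes no false match, because the indicator then forces `κ` to be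
-- empty. Together with `corner-add` this brings removal and addition to the same `δ`.
corner-remove : ∀ s → Bounded (suc x) μ → Bounded (suc y) κ →
  ⟦ top κ ≤? y ⟧ * (s * δ (suc x ∷ μ) (y ∷⁰ κ)) ≡ s * δ (suc x ∷ μ) (y ∷ κ)
corner-remove {x} {μ} {y} {κ} s μ≤ κ≤ with ≡-dec _≟_ (suc x ∷ μ) (y ∷ κ)
... | yes refl = trans (cong₂ (λ k l → k * (s * l)) (⟦⟧-true (top μ ≤? suc x) (top≤ μ≤)) (δ-refl (suc x ∷ μ)))
                       (ℤ.*-identityˡ (s * 1ℤ))
... | no neq = trans (⟦⟧*-cong (top κ ≤? y) λ t≤y → cong (s *_) (δ-≢ (≢⁰ y κ≤ t≤y neq)))
                   (trans (cong (⟦ top κ ≤? y ⟧ *_) (ℤ.*-zeroʳ s))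
                   (trans (ℤ.*-zeroʳ ⟦ top κ ≤? y ⟧) (sym (ℤ.*-zeroʳ s))))
  where
  ≢⁰ : ∀ y → Bounded (suc y) κ → top κ ≤ y → suc x ∷ μ ≢ y ∷ κ → suc x ∷ μ ≢ y ∷⁰ κ
  ≢⁰ zero    [] _ _ ()
  ≢⁰ (suc y) _  _ neq = neq

corner-add : ∀ s → suc y ≤ b →
  ⟦ suc x <? b ⟧ * (s * δ (suc y ∷ κ) (suc (suc x) ∷ μ)) ≡ s * δ (suc x ∷ μ) (y ∷ κ)
corner-add {y} {b} {x} {κ} {μ} s y<b with ≡-dec _≟_ (suc x ∷ μ) (y ∷ κ)
... | yes refl = trans (cong₂ (λ k l → k * (s * l)) (⟦⟧-true (suc x <? b) y<b) (δ-refl (suc (suc x) ∷ μ)))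
                       (ℤ.*-identityˡ (s * 1ℤ))
... | no neq = trans (cong (λ k → ⟦ suc x <? b ⟧ * (s * k)) (δ-≢ λ { refl → neq refl }))
                   (trans (cong (⟦ suc x <? b ⟧ *_) (ℤ.*-zeroʳ s))
                   (trans (ℤ.*-zeroʳ ⟦ suc x <? b ⟧) (sym (ℤ.*-zeroʳ s))))

-- Induction on rows. If the first rows agree, the tails differ by one cell and the resulting sign
-- is the minus in the recursion of `add`. If the tails agree and the first row of `κ` is longer by
-- one, both sides carry the same sign. In all other cases both are 0.
adjoint-δ : Bounded b μ → Bounded b κ → sum κ ≡ suc (sum μ) →
  sgn (e κ) * remove (δ μ) κ ≡ sgn (e μ) * add b (δ κ) μ
adjoint-δ {b} [] (_∷_ {x = zero} 0<b []) refl =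
  trans (cong (λ k → 1ℤ * (1ℤ * (1ℤ * k) + 0ℤ)) (δ-refl []))
        (sym (cong₂ (λ k l → 1ℤ * (k * l)) (⟦⟧-true (0 <? b) 0<b) (δ-refl [ 1 ])))
adjoint-δ [] (_∷_ {x = zero} _ (_∷_ {x = x} _ _)) ()
adjoint-δ {b} (_∷_ {x = x} {μ = μ} x<b μ≤) (_∷_ {x = y} {μ = κ} y<b κ≤) size = begin
  sgn (e (suc y ∷ κ)) * (⟦ top κ ≤? y ⟧ * (sgn (sum κ) * δ (suc x ∷ μ) (y ∷⁰ κ))
    + remove (λ ρ → δ (suc x ∷ μ) (suc y ∷ ρ)) κ)
    ≡⟨ cong₂ _*_ (sgn-e-∷ (suc y) κ)
         (cong₂ _+_ (corner-remove (sgn (sum κ)) μ≤ κ≤) (remove-δ-∷ (suc x) (suc y) μ κ)) ⟩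
  sgn (sum κ) * sgn (e κ) * (sgn (sum κ) * Δ + ⟦ suc x ≟ suc y ⟧ * remove (δ μ) κ)
    ≡⟨ compare ⟩
  sgn (sum μ) * sgn (e μ) * (sgn (sum μ) * Δ - ⟦ suc y ≟ suc x ⟧ * add (suc x) (δ κ) μ)
    ≡⟨ cong₂ _*_ (sgn-e-∷ (suc x) μ)
         (cong₂ _-_ (corner-add (sgn (sum μ)) y<b) (add-δ-∷ (suc y) (suc x) κ μ)) ⟨
  sgn (e (suc x ∷ μ)) * (⟦ suc x <? b ⟧ * (sgn (sum μ) * δ (suc y ∷ κ) (suc (suc x) ∷ μ))
    - add (suc x) (λ ρ → δ (suc y ∷ κ) (suc x ∷ ρ)) μ) ∎
  where
  open ≡-Reasoning
  Δ = δ (suc x ∷ μ) (y ∷ κ)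

  same-row : ∀ s e r a e′ → e * r ≡ e′ * a →
    - s * e * (- s * 0ℤ + 1ℤ * r) ≡ s * e′ * (s * 0ℤ - 1ℤ * a)
  same-row s e r a e′ ih = trans (left s e r) (trans (cong (λ k → - s * k) ih) (right s e′ a))
    where
    left : ∀ s e r → - s * e * (- s * 0ℤ + 1ℤ * r) ≡ - s * (e * r)
    left = solve-∀
    right : ∀ s e a → - s * (e * a) ≡ s * e * (s * 0ℤ - 1ℤ * a)
    right = solve-∀

  first-row : ∀ s e r a → s * e * (s * 1ℤ + 0ℤ * r) ≡ s * e * (s * 1ℤ - 0ℤ * a)
  first-row = solve-∀

  vanish : ∀ s e r s′ e′ a → s * e * (s * 0ℤ + 0ℤ * r) ≡ s′ * e′ * (s′ * 0ℤ - 0ℤ * a)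
  vanish = solve-∀

  compare : sgn (sum κ) * sgn (e κ) * (sgn (sum κ) * Δ + ⟦ suc x ≟ suc y ⟧ * remove (δ μ) κ)
    ≡ sgn (sum μ) * sgn (e μ) * (sgn (sum μ) * Δ - ⟦ suc y ≟ suc x ⟧ * add (suc x) (δ κ) μ)
  compare with x ≟ y
  ... | yes refl
    rewrite ⟦⟧-true (suc x ≟ suc x) refl
          | δ-≢ {suc x ∷ μ} {x ∷ κ} (λ eq → ℕ.1+n≢n (proj₁ (∷-injective eq)))
          | ℕ.+-cancelˡ-≡ (suc x) (sum κ) (suc (sum μ)) (trans size (sym (ℕ.+-suc (suc x) (sum μ))))
          | sgn-suc (sum μ)
    = same-row (sgn (sum μ)) (sgn (e κ)) (remove (δ μ) κ) (add (suc x) (δ κ) μ) (sgn (e μ))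
        (adjoint-δ μ≤ κ≤ (ℕ.+-cancelˡ-≡ (suc x) (sum κ) (suc (sum μ))
          (trans size (sym (ℕ.+-suc (suc x) (sum μ))))))
  ... | no x≢y
    rewrite ⟦⟧-false (suc x ≟ suc y) (x≢y ∘ ℕ.suc-injective)
          | ⟦⟧-false (suc y ≟ suc x) (x≢y ∘ sym ∘ ℕ.suc-injective)
    with ≡-dec _≟_ (suc x ∷ μ) (y ∷ κ)
  ...   | yes refl = first-row (sgn (sum μ)) (sgn (e μ)) (remove (δ μ) μ) (add (suc x) (δ μ) μ)
  ...   | no _     = vanish (sgn (sum κ)) (sgn (e κ)) (remove (δ μ) κ)
                       (sgn (sum μ)) (sgn (e μ)) (add (suc x) (δ κ) μ)

-- Covering relation on shapes

infix 4 _⋖_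

-- The longer row is given by an equation because, for a row extended by `∷ʳ`, its length equals the
-- required successor only propositionally.
data _⋖_ : List ℕ → List ℕ → Set where
  new   : [] ⋖ [ 1 ]
  here  : y ≡ suc (suc x) → (suc x ∷ μ) ⋖ (y ∷ μ)
  there : μ ⋖ κ → (x ∷ μ) ⋖ (x ∷ κ)

below : μ ⋖ κ → ℕ
below new              = 0
below (here {μ = μ} _) = sum μ
below (there p)        = below p

-- Only one row of `κ` can be shortened to give `μ`, so the matrix entry is a single sign; its
-- exponent is the number of inversions gained in `Grow-inv`.
remove-δ-⋖ : (p : μ ⋖ κ) → Bounded b μ → Bounded b κ → remove (δ μ) κ ≡ sgn (below p)
remove-δ-⋖ new _ _ = cong (λ k → 1ℤ * (1ℤ * k) + 0ℤ) (δ-refl [])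
remove-δ-⋖ (here {x = x} {μ = μ} refl) (_ ∷ μ≤) (_ ∷ κ≤) = begin
  ⟦ top μ ≤? suc x ⟧ * (sgn (sum μ) * δ (suc x ∷ μ) (suc x ∷ μ))
    + remove (λ ρ → δ (suc x ∷ μ) (suc (suc x) ∷ ρ)) μ
    ≡⟨ cong₂ _+_ (corner-remove (sgn (sum μ)) μ≤ κ≤) (trans (remove-δ-∷ (suc x) (suc (suc x)) μ μ)
         (cong (_* remove (δ μ) μ) (⟦⟧-false (suc x ≟ suc (suc x)) (ℕ.1+n≢n ∘ sym)))) ⟩
  sgn (sum μ) * δ (suc x ∷ μ) (suc x ∷ μ) + 0ℤ
    ≡⟨ ℤ.+-identityʳ _ ⟩
  sgn (sum μ) * δ (suc x ∷ μ) (suc x ∷ μ)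
    ≡⟨ cong (sgn (sum μ) *_) (δ-refl (suc x ∷ μ)) ⟩
  sgn (sum μ) * 1ℤ
    ≡⟨ ℤ.*-identityʳ (sgn (sum μ)) ⟩
  sgn (sum μ) ∎
  where open ≡-Reasoning
remove-δ-⋖ (there {μ = μ} {κ = κ} p) (_∷_ {x = x} _ μ≤) (_ ∷ κ≤) = begin
  ⟦ top κ ≤? x ⟧ * (sgn (sum κ) * δ (suc x ∷ μ) (x ∷⁰ κ)) + remove (λ ρ → δ (suc x ∷ μ) (suc x ∷ ρ)) κ
    ≡⟨ cong₂ _+_ (trans (corner-remove (sgn (sum κ)) μ≤ κ≤)
           (trans (cong (sgn (sum κ) *_) (δ-≢ (λ eq → ℕ.1+n≢n (proj₁ (∷-injective eq)))))
                  (ℤ.*-zeroʳ (sgn (sum κ)))))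
         (trans (remove-δ-∷ (suc x) (suc x) μ κ)
           (cong₂ _*_ (⟦⟧-true (suc x ≟ suc x) refl) (remove-δ-⋖ p μ≤ κ≤))) ⟩
  0ℤ + 1ℤ * sgn (below p)
    ≡⟨ trans (ℤ.+-identityˡ _) (ℤ.*-identityˡ _) ⟩
  sgn (below p) ∎
  where open ≡-Reasoning

-- This dichotomy supplies the zero weights in the branching rule: a tableau whose shape is not
-- covered by `κ` contributes nothing.
remove-δ-zero : Bounded b μ → Bounded b κ → remove (δ μ) κ ≡ 0ℤ ⊎ μ ⋖ κ
remove-δ-zero _  []                             = inj₁ refl
remove-δ-zero [] (_∷_ {x = zero} _ [])          = inj₂ new
remove-δ-zero [] (_∷_ {x = zero} {μ = suc z ∷ κ} _ (_ ∷ _)) = inj₁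
  (cong₂ _+_ (cong (_* (sgn (sum (suc z ∷ κ)) * δ [] (suc z ∷ κ))) (⟦⟧-false (suc z ≤? 0) λ ()))
             (remove-0 (suc z ∷ κ)))
remove-δ-zero [] (_∷_ {x = suc x} {μ = κ} _ _)  = inj₁ (trans
  (cong₂ _+_ (cong (⟦ top κ ≤? suc x ⟧ *_) (ℤ.*-zeroʳ (sgn (sum κ)))) (remove-0 κ))
  (trans (ℤ.+-identityʳ _) (ℤ.*-zeroʳ ⟦ top κ ≤? suc x ⟧)))
remove-δ-zero (_∷_ {x = x} {μ = μ} _ μ≤) (_∷_ {x = y} {μ = κ} _ κ≤)
  with ≡-dec _≟_ (suc x ∷ μ) (y ∷ κ)
... | yes refl = inj₂ (here refl)
... | no neq = below-first-row (x ≟ y)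
  where
  vanishes : ⟦ suc x ≟ suc y ⟧ * remove (δ μ) κ ≡ 0ℤ → remove (δ (suc x ∷ μ)) (suc y ∷ κ) ≡ 0ℤ
  vanishes eq = cong₂ _+_
    (trans (corner-remove (sgn (sum κ)) μ≤ κ≤)
           (trans (cong (sgn (sum κ) *_) (δ-≢ neq)) (ℤ.*-zeroʳ (sgn (sum κ)))))
    (trans (remove-δ-∷ (suc x) (suc y) μ κ) eq)

  below-first-row : Dec (x ≡ y) → remove (δ (suc x ∷ μ)) (suc y ∷ κ) ≡ 0ℤ ⊎ (suc x ∷ μ) ⋖ (suc y ∷ κ)
  below-first-row (no x≢y) = inj₁ (vanishes
    (cong (_* remove (δ μ) κ) (⟦⟧-false (suc x ≟ suc y) (x≢y ∘ ℕ.suc-injective))))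
  below-first-row (yes refl) with remove-δ-zero μ≤ κ≤
  ... | inj₁ r≡0 = inj₁ (vanishes (trans (cong (⟦ suc x ≟ suc x ⟧ *_) r≡0) (ℤ.*-zeroʳ ⟦ suc x ≟ suc x ⟧)))
  ... | inj₂ p   = inj₂ (there p)

-- Summation over all partitions of n

⊢⇒Bounded : μ ⊢ n → n ≤ b → Bounded b μ
⊢⇒Bounded {μ} (mk⊢ dec pos refl) n≤b = Bounded-top (ℕ.≤-trans (top≤sum μ) n≤b) (bounded dec pos)
  where
  top≤sum : ∀ μ → top μ ≤ sum μ
  top≤sum []      = z≤n
  top≤sum (x ∷ μ) = ℕ.m≤m+n x (sum μ)
  bounded : ∀ {μ} → Linked _≥_ μ → All (0 <_) μ → Bounded (top μ) μ
  bounded []          []             = []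
  bounded [-]         (s≤s _ ∷ [])   = ℕ.≤-refl ∷ []
  bounded (x≥y ∷ dec) (s≤s _ ∷ pos)  = ℕ.≤-refl ∷ Bounded-weaken x≥y (bounded dec pos)

Bounded⇒⊢ : Bounded b μ → sum μ ≡ n → μ ⊢ n
Bounded⇒⊢ μ≤ refl = mk⊢ (decreasing μ≤) (positive μ≤) refl
  where
  decreasing : Bounded b μ → Linked _≥_ μ
  decreasing []             = []
  decreasing (_ ∷ [])       = [-]
  decreasing (_ ∷ (p ∷ ps)) = p ∷ decreasing (p ∷ ps)
  positive : Bounded b μ → All (0 <_) μ
  positive []       = []
  positive (_ ∷ ps) = s≤s z≤n ∷ positive ps

⊢⇒∈ : μ ⊢ n → μ ∈ partitions n
⊢⇒∈ = Equivalence.from ∈-partitions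

∈⇒⊢ : μ ∈ partitions n → μ ⊢ n
∈⇒⊢ = Equivalence.to ∈-partitions

sumOver-partitions-δ : ∀ f → ρ ⊢ n → f ρ ≡ sumOver (partitions n) (λ μ → f μ * δ μ ρ)
sumOver-partitions-δ {n = n} f ρ⊢n = sym (sumOver-δ f (partitions-unique n) (⊢⇒∈ ρ⊢n))

-- On partitions of `n`, `f` is the combination of the functions `δ μ` with coefficients `f μ`;
-- linearity does the rest. The same argument gives `add-expand`.
remove-expand : ∀ n f → κ ⊢ suc n → remove f κ ≡ sumOver (partitions n) (λ μ → f μ * remove (δ μ) κ)
remove-expand {κ} n f κ⊢ = begin
  remove f κ
    ≡⟨ remove-cong κ (λ μ bnd size → sumOver-partitions-δ f
         (Bounded⇒⊢ (bnd (⊢⇒Bounded κ⊢ ℕ.≤-refl)) (ℕ.suc-injective (trans size (_⊢_.total κ⊢))))) ⟩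
  remove (λ ρ → sumOver (partitions n) (λ μ → f μ * δ μ ρ)) κ
    ≡⟨ remove-sumOver (λ μ ρ → f μ * δ μ ρ) (partitions n) κ ⟩
  sumOver (partitions n) (λ μ → remove (λ ρ → f μ * δ μ ρ) κ)
    ≡⟨ sumOver-cong (partitions n) (λ {μ} _ → remove-* (f μ) (δ μ) κ) ⟩
  sumOver (partitions n) (λ μ → f μ * remove (δ μ) κ) ∎
  where open ≡-Reasoning

add-expand : ∀ n f → μ ⊢ n → n ≤ b → add b f μ ≡ sumOver (partitions (suc n)) (λ κ → f κ * add b (δ κ) μ)
add-expand {μ} {b} n f μ⊢ n≤b = begin
  add b f μ
    ≡⟨ add-cong μ (λ κ bnd size → sumOver-partitions-δ f
         (Bounded⇒⊢ (bnd (⊢⇒Bounded μ⊢ n≤b)) (trans size (cong suc (_⊢_.total μ⊢))))) ⟩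
  add b (λ ρ → sumOver (partitions (suc n)) (λ κ → f κ * δ κ ρ)) μ
    ≡⟨ add-sumOver b (λ κ ρ → f κ * δ κ ρ) (partitions (suc n)) μ ⟩
  sumOver (partitions (suc n)) (λ κ → add b (λ ρ → f κ * δ κ ρ) μ)
    ≡⟨ sumOver-cong (partitions (suc n)) (λ {κ} _ → add-* b (f κ) (δ κ) μ) ⟩
  sumOver (partitions (suc n)) (λ κ → f κ * add b (δ κ) μ) ∎
  where open ≡-Reasoning

-- Both sides expand into matrix entries, which agree by `adjoint-δ` once the sums are interchanged.
-- The bound `suc n` excludes no partition of `suc n`.
adjoint : ∀ n f g →
  sumOver (partitions (suc n)) (λ κ → sgn (e κ) * (remove f κ * g κ))
    ≡ sumOver (partitions n) (λ μ → sgn (e μ) * (f μ * add (suc n) g μ))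
adjoint n f g = begin
  sumOver κs (λ κ → sgn (e κ) * (remove f κ * g κ))
    ≡⟨ sumOver-cong κs (λ {κ} κ∈ → trans
         (cong (λ k → sgn (e κ) * (k * g κ)) (remove-expand n f (∈⇒⊢ κ∈)))
         (trans (comm (sgn (e κ)) _ (g κ)) (sym (sumOver-*ˡ (sgn (e κ) * g κ) _ μs)))) ⟩
  sumOver κs (λ κ → sumOver μs (λ μ → sgn (e κ) * g κ * (f μ * remove (δ μ) κ)))
    ≡⟨ sumOver-swap (λ κ μ → sgn (e κ) * g κ * (f μ * remove (δ μ) κ)) κs μs ⟩
  sumOver μs (λ μ → sumOver κs (λ κ → sgn (e κ) * g κ * (f μ * remove (δ μ) κ)))
    ≡⟨ sumOver-cong μs (λ μ∈ → sumOver-cong κs (λ κ∈ → exchange (∈⇒⊢ μ∈) (∈⇒⊢ κ∈))) ⟩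
  sumOver μs (λ μ → sumOver κs (λ κ → sgn (e μ) * f μ * (g κ * add (suc n) (δ κ) μ)))
    ≡⟨ sumOver-cong μs (λ {μ} μ∈ → trans (sumOver-*ˡ (sgn (e μ) * f μ) _ κs) (trans
         (cong (sgn (e μ) * f μ *_) (sym (add-expand n g (∈⇒⊢ μ∈) (ℕ.n≤1+n n))))
         (ℤ.*-assoc (sgn (e μ)) (f μ) _))) ⟩
  sumOver μs (λ μ → sgn (e μ) * (f μ * add (suc n) g μ)) ∎
  where
  open ≡-Reasoning
  κs = partitions (suc n)
  μs = partitions n
  comm : ∀ a b c → a * (b * c) ≡ a * c * b
  comm = solve-∀
  exchange : μ ⊢ n → κ ⊢ suc n →
    sgn (e κ) * g κ * (f μ * remove (δ μ) κ) ≡ sgn (e μ) * f μ * (g κ * add (suc n) (δ κ) μ)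
  exchange {μ} {κ} μ⊢ κ⊢ = trans (gather (sgn (e κ)) (g κ) (f μ) (remove (δ μ) κ)) (trans
    (cong (λ k → g κ * f μ * k) (adjoint-δ (⊢⇒Bounded μ⊢ (ℕ.n≤1+n n)) (⊢⇒Bounded κ⊢ ℕ.≤-refl)
      (trans (_⊢_.total κ⊢) (cong suc (sym (_⊢_.total μ⊢))))))
    (scatter (sgn (e μ)) (g κ) (f μ) (add (suc n) (δ κ) μ)))
    where
    gather : ∀ a b c d → a * b * (c * d) ≡ b * c * (a * d)
    gather = solve-∀
    scatter : ∀ a b c d → b * c * (a * d) ≡ a * c * (b * d)
    scatter = solve-∀

-- Functions fixed by removal are eigenvectors of addition

eigenvalue : ℕ → ℤ
eigenvalue zero    = 1ℤ
eigenvalue (suc n) = 1ℤ - eigenvalue n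

-- From U f = f and DU + UD = 1 follows D f = f - U D f, and by induction U D f is the previous
-- eigenvalue times f. The condition `n < b` leaves room for a new cell in the first row, so the
-- commutation coefficient is 1.
add-eigen : ∀ f → (∀ {n κ} → κ ⊢ suc n → f κ ≡ remove f κ) →
  ∀ n → μ ⊢ n → n < b → add b f μ ≡ eigenvalue n * f μ
add-eigen {μ} {b} f rec n μ⊢ n<b = begin
  add b f μ
    ≡⟨ add-cong μ (λ κ bnd size → rec (Bounded⇒⊢ (bnd μ≤) (trans size (cong suc (_⊢_.total μ⊢))))) ⟩
  add b (remove f) μ
    ≡⟨ cancel (add b (remove f) μ) (remove (add b f) μ) ⟩
  (add b (remove f) μ + remove (add b f) μ) - remove (add b f) μ
    ≡⟨ cong₂ _-_
         (trans (commutation f μ≤)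
           (trans (cong (_* f μ) (⟦⟧-true (top μ <? b) top<b)) (ℤ.*-identityˡ (f μ))))
         (remove-add n μ⊢ n<b) ⟩
  f μ - lowered n
    ≡⟨ combine n ⟩
  eigenvalue n * f μ ∎
  where
  open ≡-Reasoning
  μ≤ : Bounded b μ
  μ≤ = ⊢⇒Bounded μ⊢ (ℕ.<⇒≤ n<b)
  top<b : top μ < b
  top<b = ℕ.≤-<-trans (top≤ (⊢⇒Bounded μ⊢ ℕ.≤-refl)) n<b

  -- The value of U D f at `μ`: nothing can be removed from the empty partition, which gives the
  -- initial eigenvalue 1.
  lowered : ℕ → ℤ
  lowered zero    = 0ℤ
  lowered (suc n) = eigenvalue n * f μ

  remove-add : ∀ n → μ ⊢ n → n < b → remove (add b f) μ ≡ lowered n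
  remove-add zero    μ⊢ _ with Bounded-0 (⊢⇒Bounded μ⊢ ℕ.≤-refl)
  ... | refl = refl
  remove-add (suc n) μ⊢ n<b = trans
    (remove-cong μ λ ρ bnd size → add-eigen f rec n
      (Bounded⇒⊢ (bnd μ≤) (ℕ.suc-injective (trans size (_⊢_.total μ⊢)))) (ℕ.<⇒≤ n<b))
    (trans (remove-* (eigenvalue n) f μ) (cong (eigenvalue n *_) (sym (rec μ⊢))))

  cancel : ∀ a c → a ≡ a + c - c
  cancel = solve-∀
  combine : ∀ n → f μ - lowered n ≡ eigenvalue n * f μ
  combine zero    = unit (f μ)
    where
    unit : ∀ a → a - 0ℤ ≡ 1ℤ * a
    unit = solve-∀
  combine (suc n) = factor (f μ) (eigenvalue n)
    where
    factor : ∀ a c → a - c * a ≡ (1ℤ - c) * a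
    factor = solve-∀

-- Tableaux

shape : List (List ℕ) → List ℕ
shape = map length

length-concat : ∀ (T : List (List ℕ)) → length (concat T) ≡ sum (shape T)
length-concat []      = refl
length-concat (r ∷ T) = trans (length-++ r) (cong (length r ℕ.+_) (length-concat T))

length-∷ʳ : ∀ r → length (r ∷ʳ m) ≡ suc (length r)
length-∷ʳ r = trans (length-++ r) (ℕ.+-comm (length r) 1)

-- Standardness is left out, so that adding and deleting the largest entry can share one relation.
-- `here` asks for a nonempty row, so a row is started only by `new`, at the bottom.
data Grow (m : ℕ) : List (List ℕ) → List (List ℕ) → Set where
  new   : Grow m [] ([ m ] ∷ [])
  here  : Grow m ((x ∷ r) ∷ T) ((x ∷ r ∷ʳ m) ∷ T)
  there : Grow m T U → Grow m (r ∷ T) (r ∷ U)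

Grow-⋖ : Grow m T U → shape T ⋖ shape U
Grow-⋖ new               = new
Grow-⋖ (here {r = r})    = here (cong suc (length-∷ʳ r))
Grow-⋖ (there G)         = there (Grow-⋖ G)

Grow-exists : ∀ m T → shape T ⋖ κ → ∃[ U ] Grow m T U × shape U ≡ κ
Grow-exists m []            new         = [ m ] ∷ [] , new , refl
Grow-exists m ((x ∷ r) ∷ T) (here refl) = (x ∷ r ∷ʳ m) ∷ T , here , cong (λ k → suc k ∷ shape T) (length-∷ʳ r)
Grow-exists m (r ∷ T)       (there p)   with Grow-exists m T p
... | U , G , refl = r ∷ U , there G , refl

Grow-↭ : Grow m T U → concat U ↭ m ∷ concat T
Grow-↭ new                                      = ↭-refl
Grow-↭ {m} (here {x = x} {r = r} {T = T})       =
  ↭-trans (↭-reflexive (++-assoc (x ∷ r) [ m ] (concat T))) (shift m (x ∷ r) (concat T))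
Grow-↭ {m} (there {T = T} {r = r} G)            = ↭-trans (++⁺ˡ r (Grow-↭ G)) (shift m r (concat T))

Grow-sum : Grow m T U → sum (shape U) ≡ suc (sum (shape T))
Grow-sum {m} {T} {U} G =
  trans (sym (length-concat U)) (trans (↭-length (Grow-↭ G)) (cong suc (length-concat T)))

Grow-injective : Grow m S T → Grow m S U → shape T ≡ shape U → T ≡ U
Grow-injective new       new       _  = refl
Grow-injective here      here      _  = refl
Grow-injective (here {r = r}) (there G) eq =
  contradiction (ℕ.suc-injective (proj₁ (∷-injective eq))) (λ eq → ℕ.1+n≢n (trans (sym (length-∷ʳ r)) eq))
Grow-injective (there G) (here {r = r}) eq =
  contradiction (ℕ.suc-injective (proj₁ (∷-injective eq))) (λ eq → ℕ.1+n≢n (trans (sym (length-∷ʳ r)) (sym eq)))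
Grow-injective (there G) (there H) eq = cong (_ ∷_) (Grow-injective G H (proj₂ (∷-injective eq)))

∷ʳ≢[] : ∀ r → [] ≢ r ∷ʳ m
∷ʳ≢[] []      ()
∷ʳ≢[] (_ ∷ _) ()

∷ʳ≮ : ∀ r → All (_< m) ((r ∷ʳ m) ++ C) → A
∷ʳ≮ r p = contradiction (proj₂ (All.∷ʳ⁻ (All.++⁻ˡ (r ∷ʳ _) p))) (ℕ.<-irrefl refl)

-- Since `m` exceeds all old entries, its position in the common result shows which row grew.
Grow-functional : All (_< m) (concat S) → All (_< m) (concat T) →
  Grow m S U → Grow m T V → U ≡ V → S ≡ T
Grow-functional S< T< new                 new       _    = refl
Grow-functional S< T< new                 (here {r = r}) eq =
  contradiction (proj₂ (∷-injective (proj₁ (∷-injective eq)))) (∷ʳ≢[] r)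
Grow-functional S< T< new                 (there G) refl = ∷ʳ≮ [] T<
Grow-functional S< T< (here {r = r})      new       eq   =
  contradiction (sym (proj₂ (∷-injective (proj₁ (∷-injective eq))))) (∷ʳ≢[] r)
Grow-functional S< T< (here {r = r})      (here {r = s}) eq
  with refl , eq′ ← ∷-injective (proj₁ (∷-injective eq)) | refl ← proj₂ (∷-injective eq)
  with refl , _ ← ∷ʳ-injective r s eq′ = refl
Grow-functional S< T< (here {x = x} {r = r}) (there G) refl = ∷ʳ≮ (x ∷ r) T<
Grow-functional S< T< (there G)           new       refl = ∷ʳ≮ [] S<
Grow-functional S< T< (there G) (here {x = x} {r = r}) refl = ∷ʳ≮ (x ∷ r) S<
Grow-functional S< T< (there {r = r} G)   (there H) refl =
  cong (r ∷_) (Grow-functional (All.++⁻ʳ r S<) (All.++⁻ʳ r T<) G H refl)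

-- Signs of tableaux

crossings : List ℕ → List ℕ → ℕ
crossings r C = length (filter (λ (i , j) → j <? i) (cartesianProduct r C))

crossings-∷ : ∀ i r C → crossings (i ∷ r) C ≡ length (filter (_<? i) C) ℕ.+ crossings r C
crossings-∷ i r C = trans
  (cong length (filter-++ (λ (i , j) → j <? i) (map (i ,_) C) (cartesianProduct r C)))
  (trans (length-++ (filter (λ (i , j) → j <? i) (map (i ,_) C)))
         (cong (ℕ._+ crossings r C) (row C)))
  where
  row : ∀ C → length (filter (λ (i , j) → j <? i) (map (i ,_) C)) ≡ length (filter (_<? i) C)
  row []      = refl
  -- Both filters decide through this boolean, so splitting on it reduces them together.
  row (j ∷ C) with j ℕ.<ᵇ i
  ... | true  = cong suc (row C)
  ... | false = row C

inv-∷ : ∀ r T → inv (r ∷ T) ≡ crossings r (concat T) ℕ.+ inv T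
inv-∷ r T = length-++ (filter (λ (i , j) → j <? i) (cartesianProduct r (concat T)))

-- A largest entry forms an inversion with every cell in lower rows.
crossings-∷ʳ : ∀ r → All (_< m) C → crossings (r ∷ʳ m) C ≡ crossings r C ℕ.+ length C
crossings-∷ʳ {m} {C} []      C<m = trans (crossings-∷ m [] C)
  (trans (ℕ.+-identityʳ _) (cong length (filter-all (_<? m) C<m)))
crossings-∷ʳ {m} {C} (i ∷ r) C<m = begin
  crossings (i ∷ r ∷ʳ m) C                             ≡⟨ crossings-∷ i (r ∷ʳ m) C ⟩
  k ℕ.+ crossings (r ∷ʳ m) C                           ≡⟨ cong (k ℕ.+_) (crossings-∷ʳ r C<m) ⟩
  k ℕ.+ (crossings r C ℕ.+ length C)                   ≡⟨ ℕ.+-assoc k (crossings r C) (length C) ⟨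
  k ℕ.+ crossings r C ℕ.+ length C                     ≡⟨ cong (ℕ._+ length C) (crossings-∷ i r C) ⟨
  crossings (i ∷ r) C ℕ.+ length C ∎
  where
  open ≡-Reasoning
  k = length (filter (_<? i) C)

-- A largest entry in a lower row forms no inversion with the smaller entries above, and counting
-- inversions with a row ignores the order of the entries below it.
crossings-max : All (_< m) r → C′ ↭ m ∷ C → crossings r C′ ≡ crossings r C
crossings-max []                              p = refl
crossings-max {m} {i ∷ r} {C′} {C} (i<m ∷ r<) p = begin
  crossings (i ∷ r) C′                           ≡⟨ crossings-∷ i r C′ ⟩
  length (filter (_<? i) C′) ℕ.+ crossings r C′
    ≡⟨ cong₂ ℕ._+_ (trans (↭-length (filter-↭ (_<? i) p))
                          (cong length (filter-reject (_<? i) (ℕ.<⇒≯ i<m))))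
                   (crossings-max r< p) ⟩
  length (filter (_<? i) C) ℕ.+ crossings r C    ≡⟨ crossings-∷ i r C ⟨
  crossings (i ∷ r) C ∎
  where open ≡-Reasoning

Grow-inv : (G : Grow m T U) → All (_< m) (concat T) → inv U ≡ inv T ℕ.+ below (Grow-⋖ G)
Grow-inv new _ = refl
Grow-inv {m} (here {x = x} {r = r} {T = T}) T< = begin
  inv ((x ∷ r ∷ʳ m) ∷ T)
    ≡⟨ inv-∷ (x ∷ r ∷ʳ m) T ⟩
  crossings (x ∷ r ∷ʳ m) (concat T) ℕ.+ inv T
    ≡⟨ cong (ℕ._+ inv T) (crossings-∷ʳ (x ∷ r) (All.++⁻ʳ (x ∷ r) T<)) ⟩
  crossings (x ∷ r) (concat T) ℕ.+ length (concat T) ℕ.+ inv T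
    ≡⟨ comm (crossings (x ∷ r) (concat T)) (length (concat T)) (inv T) ⟩
  crossings (x ∷ r) (concat T) ℕ.+ inv T ℕ.+ length (concat T)
    ≡⟨ cong₂ ℕ._+_ (sym (inv-∷ (x ∷ r) T)) (length-concat T) ⟩
  inv ((x ∷ r) ∷ T) ℕ.+ sum (shape T) ∎
  where
  open ≡-Reasoning
  comm : ∀ a b c → a ℕ.+ b ℕ.+ c ≡ a ℕ.+ c ℕ.+ b
  comm a b c = trans (ℕ.+-assoc a b c) (trans (cong (a ℕ.+_) (ℕ.+-comm b c)) (sym (ℕ.+-assoc a c b)))
Grow-inv {m} (there {T = T} {U = U} {r = r} G) T< = begin
  inv (r ∷ U)
    ≡⟨ inv-∷ r U ⟩
  crossings r (concat U) ℕ.+ inv U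
    ≡⟨ cong₂ ℕ._+_ (crossings-max (All.++⁻ˡ r T<) (Grow-↭ G)) (Grow-inv G (All.++⁻ʳ r T<)) ⟩
  crossings r (concat T) ℕ.+ (inv T ℕ.+ below (Grow-⋖ G))
    ≡⟨ ℕ.+-assoc (crossings r (concat T)) (inv T) _ ⟨
  crossings r (concat T) ℕ.+ inv T ℕ.+ below (Grow-⋖ G)
    ≡⟨ cong (ℕ._+ below (Grow-⋖ G)) (inv-∷ r T) ⟨
  inv (r ∷ T) ℕ.+ below (Grow-⋖ G) ∎
  where open ≡-Reasoning

-- Standardness of grown tableaux

Linked-∷ʳ : Linked _<_ r → All (_< m) r → Linked _<_ (r ∷ʳ m)
Linked-∷ʳ []       []         = [-]
Linked-∷ʳ [-]      (p ∷ [])   = p ∷ [-]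
Linked-∷ʳ (l ∷ ls) (_ ∷ ps)   = l ∷ Linked-∷ʳ ls ps

Linked-∷ʳ⁻ : ∀ r → Linked _<_ (r ∷ʳ m) → Linked _<_ r
Linked-∷ʳ⁻ []          _        = []
Linked-∷ʳ⁻ (x ∷ [])    _        = [-]
Linked-∷ʳ⁻ (x ∷ y ∷ r) (l ∷ ls) = l ∷ Linked-∷ʳ⁻ (y ∷ r) ls

-- `zip` either drops the new cell or pairs it with an entry of `r`, which is smaller than `m`.
Above-∷ʳ : ∀ r s → All (_< m) r → r Above s → r Above (s ∷ʳ m)
Above-∷ʳ []      s       _        _        = []
Above-∷ʳ (x ∷ []) []     (p ∷ _)  _        = p ∷ []
Above-∷ʳ (x ∷ y ∷ r) []  (p ∷ _)  _        = p ∷ []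
Above-∷ʳ (x ∷ r) (y ∷ s) (_ ∷ ps) (l ∷ ls) = l ∷ Above-∷ʳ r s ps ls

Above-∷ʳ⁻ : ∀ r s → r Above (s ∷ʳ m) → r Above s
Above-∷ʳ⁻ []      s       _        = []
Above-∷ʳ⁻ (x ∷ r) []      _        = []
Above-∷ʳ⁻ (x ∷ r) (y ∷ s) (l ∷ ls) = l ∷ Above-∷ʳ⁻ r s ls

-- The lower row ends before the new column, so `zip` never reaches the appended entry.
∷ʳ-Above : ∀ r s → length s ≤ length r → r Above s → (r ∷ʳ m) Above s
∷ʳ-Above []      []      _       _        = []
∷ʳ-Above (x ∷ r) []      _       _        = []
∷ʳ-Above (x ∷ r) (y ∷ s) (s≤s p) (l ∷ ls) = l ∷ ∷ʳ-Above r s p ls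

∷ʳ-Above⁻ : ∀ r s → (r ∷ʳ m) Above s → r Above s
∷ʳ-Above⁻ []      s       _        = []
∷ʳ-Above⁻ (x ∷ r) []      _        = []
∷ʳ-Above⁻ (x ∷ r) (y ∷ s) (l ∷ ls) = l ∷ ∷ʳ-Above⁻ r s ls

-- A cell under `m` would hold a smaller entry, against the column condition.
∷ʳ-Above-length : ∀ r s → All (_< m) s → (r ∷ʳ m) Above s → length s ≤ length r
∷ʳ-Above-length r       []      _         _         = z≤n
∷ʳ-Above-length []      (y ∷ s) (y<m ∷ _) (m<y ∷ _) = contradiction m<y (ℕ.<⇒≯ y<m)
∷ʳ-Above-length (x ∷ r) (y ∷ s) (_ ∷ ps)  (_ ∷ ls)  = s≤s (∷ʳ-Above-length r s ps ls)

Grow-rows : Grow m T U → All (_< m) (concat T) → All (Linked _<_) T → All (Linked _<_) U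
Grow-rows new _ _ = [-] ∷ []
Grow-rows (here {x = x} {r = r}) T< (l ∷ ls) = Linked-∷ʳ l (All.++⁻ˡ (x ∷ r) T<) ∷ ls
Grow-rows (there {r = r} G) T< (l ∷ ls)      = l ∷ Grow-rows G (All.++⁻ʳ r T<) ls

Grow-rows⁻ : Grow m T U → All (Linked _<_) U → All (Linked _<_) T
Grow-rows⁻ new                    _        = []
Grow-rows⁻ (here {x = x} {r = r}) (l ∷ ls) = Linked-∷ʳ⁻ (x ∷ r) l ∷ ls
Grow-rows⁻ (there G)              (l ∷ ls) = l ∷ Grow-rows⁻ G ls

Grow-columns : Grow m T U → All (_< m) (concat T) → Bounded b (shape T) →
  Linked _Above_ T → Linked _Above_ U
Grow-columns new _ _ _ = [-]
Grow-columns here _ _ [-] = [-]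
Grow-columns (here {x = x} {r = r} {T = s ∷ _}) _ T≤ (l ∷ ls) =
  ∷ʳ-Above (x ∷ r) s (top≤ (Bounded-tail T≤)) l ∷ ls
Grow-columns (there {r = r} new) T< _ _ = Above-∷ʳ r [] (All.++⁻ˡ r T<) (Above-[] r) ∷ [-]
  where
  Above-[] : ∀ r → r Above []
  Above-[] []      = []
  Above-[] (_ ∷ _) = []
-- The inner growth is inspected to learn whether the row directly under `r` is the one that gained
-- `m`.
Grow-columns (there {r = r} G@(here {x = x} {r = s})) T< T≤ (l ∷ ls) =
  Above-∷ʳ r (x ∷ s) (All.++⁻ˡ r T<) l ∷ Grow-columns G (All.++⁻ʳ r T<) (Bounded-tail T≤) ls
Grow-columns (there {r = r} G@(there _)) T< T≤ (l ∷ ls) =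
  l ∷ Grow-columns G (All.++⁻ʳ r T<) (Bounded-tail T≤) ls

Grow-columns⁻ : Grow m T U → Linked _Above_ U → Linked _Above_ T
Grow-columns⁻ new _ = []
Grow-columns⁻ here [-] = [-]
Grow-columns⁻ (here {x = x} {r = r} {T = s ∷ _}) (l ∷ ls) = ∷ʳ-Above⁻ (x ∷ r) s l ∷ ls
Grow-columns⁻ (there new) _ = [-]
Grow-columns⁻ (there {r = r} G@(here {x = x} {r = s})) (l ∷ ls) =
  Above-∷ʳ⁻ r (x ∷ s) l ∷ Grow-columns⁻ G ls
Grow-columns⁻ (there G@(there _)) (l ∷ ls) = l ∷ Grow-columns⁻ G ls

-- No row reaches under the largest entry, so its cell is a corner and deleting it leaves a
-- partition.
Grow-Bounded⁻ : Grow m T U → All (_< m) (concat T) → Linked _Above_ U →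
  Bounded b (shape U) → Bounded b (shape T)
Grow-Bounded⁻ new _ _ _ = []
Grow-Bounded⁻ {b = b} (here {x = x} {r = r} {T = T}) T< ls (p ∷ ps) =
  ℕ.≤-trans (ℕ.n≤1+n _) (subst (λ k → suc k ≤ b) (length-∷ʳ r) p)
  ∷ Bounded-top (next-row T (All.++⁻ʳ (x ∷ r) T<) ls) ps
  where
  next-row : ∀ T → All (_< _) (concat T) → Linked _Above_ ((x ∷ r ∷ʳ _) ∷ T) → top (shape T) ≤ suc (length r)
  next-row []      _  _       = z≤n
  next-row (s ∷ T) T< (l ∷ _) = ∷ʳ-Above-length (x ∷ r) s (All.++⁻ˡ s T<) l
Grow-Bounded⁻ (there {r = x ∷ r} G) T< ls (p ∷ ps) =
  p ∷ Grow-Bounded⁻ G (All.++⁻ʳ (x ∷ r) T<) (Linked.tail ls) ps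

-- In an increasing row a successor of `m` would exceed the maximum.
last-max : m ∈ r → All (_≤ m) r → Linked _<_ r → ∃[ s ] r ≡ s ∷ʳ m
last-max (here refl)  _              [-]     = [] , refl
last-max (here refl)  (_ ∷ y≤m ∷ _)  (m<y ∷ _) = contradiction m<y (ℕ.≤⇒≯ y≤m)
last-max {r = x ∷ _} (there m∈) (_ ∷ ps) l with last-max m∈ ps (Linked.tail l)
... | s , refl = x ∷ s , refl

Grow-exists⁻ : ∀ U → m ∈ concat U → All (_≤ m) (concat U) → All (Linked _<_) U →
  Linked _Above_ U → Bounded b (shape U) → ∃[ T ] Grow m T U
Grow-exists⁻ {m} (r ∷ U) m∈ U≤ (l ∷ ls) cs U≤b with ∈-++⁻ r m∈
... | inj₂ m∈U =
  let T , G = Grow-exists⁻ U m∈U (All.++⁻ʳ r U≤) ls (Linked.tail cs) (Bounded-tail U≤b)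
  in r ∷ T , there G
... | inj₁ m∈r with last-max m∈r (All.++⁻ˡ r U≤) l
...   | x ∷ s , refl = (x ∷ s) ∷ U , here
-- The row is just `m`. An entry under it would be at most `m`, and an empty row is excluded by the
-- shape, so this is the last row and `new` applies.
...   | []    , refl with U | cs | U≤b | U≤
...     | []          | _             | _  | _             = [] , new
...     | [] ∷ _      | _             | _ ∷ () | _
...     | (y ∷ _) ∷ _ | (m<y ∷ _) ∷ _ | _  | _ ∷ y≤m ∷ _   = contradiction m<y (ℕ.≤⇒≯ y≤m)

[1⋯]-snoc : ∀ n → [1⋯ suc n ] ↭ suc n ∷ [1⋯ n ]
[1⋯]-snoc n = ↭-trans (↭-reflexive (sym (applyUpTo-∷ʳ suc n))) (↭-sym (∷↭∷ʳ (suc n) [1⋯ n ]))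

module _ (sum≡ : sum (shape T) ≡ n) where

  SYT-entries< : IsSYT (shape T) T → All (_< suc n) (concat T)
  SYT-entries< t = All-resp-↭ (↭-sym (IsSYT.entries t))
    (All.applyUpTo⁺₁ suc _ (λ i< → s≤s (subst (_ <_) sum≡ i<)))

  SYT-Grow : Bounded b (shape T) → Grow (suc n) T U → IsSYT (shape T) T → IsSYT (shape U) U
  SYT-Grow T≤ G t@(mkSYT _ entries rows columns) = mkSYT refl
    (↭-trans (Grow-↭ G) (↭-trans (prep (suc n) entries)
      (subst (λ k → suc n ∷ [1⋯ k ] ↭ [1⋯ _ ]) (sym sum≡)
        (subst (λ k → suc n ∷ [1⋯ n ] ↭ [1⋯ k ]) (sym (trans (Grow-sum G) (cong suc sum≡)))
          (↭-sym ([1⋯]-snoc n))))))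
    (Grow-rows G T< rows)
    (Grow-columns G T< T≤ columns)
    where T< = SYT-entries< t

  SYT-Grow⁻ : Grow (suc n) T U → IsSYT (shape U) U → IsSYT (shape T) T
  SYT-Grow⁻ {U = U} G (mkSYT _ entries rows columns) = mkSYT refl
    (drop-∷ (↭-trans (↭-sym (Grow-↭ G)) (↭-trans entries
      (subst (λ k → [1⋯ sum (shape U) ] ↭ suc n ∷ [1⋯ k ]) (sym sum≡)
        (subst (λ k → [1⋯ k ] ↭ suc n ∷ [1⋯ n ]) (sym (trans (Grow-sum G) (cong suc sum≡)))
          ([1⋯]-snoc n))))))
    (Grow-rows⁻ G rows)
    (Grow-columns⁻ G columns)

-- Branching rule

allTableaux : ℕ → List (List (List ℕ))
allTableaux n = concatMap tableaux (partitions n)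

∈-allTableaux⁺ : Bounded b (shape T) → sum (shape T) ≡ n → IsSYT (shape T) T → T ∈ allTableaux n
∈-allTableaux⁺ T≤ sum≡ t =
  ∈-concatMap⁺ tableaux (lose (⊢⇒∈ (Bounded⇒⊢ T≤ sum≡)) (Equivalence.from ∈-tableaux t))

∈-allTableaux⁻ : T ∈ allTableaux n → shape T ⊢ n × IsSYT (shape T) T
∈-allTableaux⁻ {T} {n} T∈ with find (∈-concatMap⁻ tableaux {xs = partitions n} T∈)
... | μ , μ∈ , T∈μ with Equivalence.to (∈-tableaux {μ} {T}) T∈μ
...   | t@(mkSYT refl _ _ _) = ∈⇒⊢ μ∈ , t

allTableaux-unique : ∀ n → Unique (allTableaux n)
allTableaux-unique n = Unique.concat⁺
  (All.map⁺ (All.universal tableaux-unique (partitions n)))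
  (AllPairs.map⁺ (AllPairs.map (λ {μ} {ν} μ≢ν {T} (p , q) → μ≢ν (trans
    (sym (IsSYT.shape (Equivalence.to (∈-tableaux {μ} {T}) p)))
    (IsSYT.shape (Equivalence.to (∈-tableaux {ν} {T}) q)))) (partitions-unique n)))

-- Deleting the largest entry matches the tableaux of `κ` with those tableaux of size `n` whose
-- shape `κ` covers. The matrix entry in `weight` is the sign change there and 0 elsewhere.
branching : κ ⊢ suc n → imbalance κ ≡ remove imbalance κ
branching {κ} {n} κ⊢ = begin
  sumOver (tableaux κ) (λ U → sgn (inv U))
    ≡⟨ sumOver-matching _~_ (λ U → sgn (inv U)) weight functional injective sign
         (tableaux-unique κ) (allTableaux-unique n) total cover ⟩
  sumOver (allTableaux n) weight
    ≡⟨ sumOver-concatMap weight tableaux (partitions n) ⟩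
  sumOver (partitions n) (λ μ → sumOver (tableaux μ) weight)
    ≡⟨ sumOver-cong (partitions n) (λ {μ} _ → trans
         (sumOver-cong (tableaux μ) λ {T} T∈ →
           cong (λ ν → remove (δ ν) κ * sgn (inv T)) (IsSYT.shape (Equivalence.to ∈-tableaux T∈)))
         (trans (sumOver-*ˡ (remove (δ μ) κ) (λ T → sgn (inv T)) (tableaux μ)) (ℤ.*-comm _ (imbalance μ)))) ⟩
  sumOver (partitions n) (λ μ → imbalance μ * remove (δ μ) κ)
    ≡⟨ remove-expand n imbalance κ⊢ ⟨
  remove imbalance κ ∎
  where
  open ≡-Reasoning
  κ≤ : Bounded (suc n) κ
  κ≤ = ⊢⇒Bounded κ⊢ ℕ.≤-refl

  weight : List (List ℕ) → ℤ
  weight T = remove (δ (shape T)) κ * sgn (inv T)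

  -- The relation carries its own bounds because uniqueness and sign agreement are required for all
  -- related pairs, without membership in the lists.
  data _~_ (U T : List (List ℕ)) : Set where
    matched : shape U ≡ κ → Grow (suc n) T U → All (_< suc n) (concat T) → Bounded (suc n) (shape T) → U ~ T

  functional : ∀ {U T T′} → U ~ T → U ~ T′ → T ≡ T′
  functional (matched _ G T< _) (matched _ H T′< _) = Grow-functional T< T′< G H refl

  injective : ∀ {U U′ T} → U ~ T → U′ ~ T → U ≡ U′
  injective (matched eq G _ _) (matched eq′ H _ _) = Grow-injective G H (trans eq (sym eq′))

  sign : ∀ {U T} → U ~ T → sgn (inv U) ≡ weight T
  sign {U} {T} (matched refl G T< T≤) = begin
    sgn (inv U)                             ≡⟨ cong sgn (Grow-inv G T<) ⟩
    sgn (inv T ℕ.+ below (Grow-⋖ G))        ≡⟨ sgn-+ (inv T) _ ⟩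
    sgn (inv T) * sgn (below (Grow-⋖ G))    ≡⟨ ℤ.*-comm (sgn (inv T)) _ ⟩
    sgn (below (Grow-⋖ G)) * sgn (inv T)
      ≡⟨ cong (_* sgn (inv T)) (remove-δ-⋖ (Grow-⋖ G) T≤ κ≤) ⟨
    weight T ∎

  total : ∀ {U} → U ∈ tableaux κ → ∃[ T ] T ∈ allTableaux n × U ~ T
  total {U} U∈ with Equivalence.to (∈-tableaux {κ} {U}) U∈
  ... | u@(mkSYT refl entries rows columns) =
    T₀ , ∈-allTableaux⁺ T≤ sumT (SYT-Grow⁻ sumT G u) , matched refl G T< T≤
    where
    entries′ : concat U ↭ suc n ∷ [1⋯ n ]
    entries′ = ↭-trans (subst (λ k → concat U ↭ [1⋯ k ]) (_⊢_.total κ⊢) entries) ([1⋯]-snoc n)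
    U≤ : All (_≤ suc n) (concat U)
    U≤ = All-resp-↭ (↭-sym entries′)
      (ℕ.≤-refl ∷ All.applyUpTo⁺₁ suc n ℕ.m<n⇒m<1+n)
    shrunk = Grow-exists⁻ U (∈-resp-↭ (↭-sym entries′) (here refl)) U≤ rows columns κ≤
    T₀ = proj₁ shrunk
    G = proj₂ shrunk
    sumT : sum (shape T₀) ≡ n
    sumT = ℕ.suc-injective (trans (sym (Grow-sum G)) (_⊢_.total κ⊢))
    T< : All (_< suc n) (concat T₀)
    T< = All-resp-↭ (↭-sym (drop-∷ (↭-trans (↭-sym (Grow-↭ G)) entries′)))
      (All.applyUpTo⁺₁ suc n s≤s)
    T≤ : Bounded (suc n) (shape T₀)
    T≤ = Grow-Bounded⁻ G T< columns κ≤

  cover : ∀ {T} → T ∈ allTableaux n → weight T ≡ 0ℤ ⊎ ∃[ U ] U ∈ tableaux κ × U ~ T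
  cover {T} T∈ with ∈-allTableaux⁻ {T} {n} T∈
  ... | T⊢ , t with ⊢⇒Bounded T⊢ (ℕ.n≤1+n n)
  ...   | T≤ with remove-δ-zero T≤ κ≤
  ...     | inj₁ w≡0 = inj₁ (cong (_* sgn (inv T)) w≡0)
  ...     | inj₂ p with Grow-exists (suc n) T p
  ...       | U , G , refl = inj₂ (U , Equivalence.from ∈-tableaux (SYT-Grow (_⊢_.total T⊢) T≤ G t)
                               , matched refl G (SYT-entries< (_⊢_.total T⊢) t) T≤)

-- Recurrence for the alternating sum

alternatingSum : ℕ → ℤ
alternatingSum n = sumOver (partitions n) (λ μ → sgn (e μ) * imbalance μ ^ 2)

alternatingSum-suc : ∀ n → alternatingSum (suc n) ≡ eigenvalue n * alternatingSum n
alternatingSum-suc n = begin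
  sumOver (partitions (suc n)) (λ κ → sgn (e κ) * imbalance κ ^ 2)
    ≡⟨ sumOver-cong (partitions (suc n)) (λ {κ} κ∈ → cong (sgn (e κ) *_)
         -- Only one factor of the square is rewritten by branching; the other stays as the second
         -- argument of the form.
         (cong₂ _*_ (branching {n = n} (∈⇒⊢ κ∈)) (ℤ.*-identityʳ (imbalance κ)))) ⟩
  sumOver (partitions (suc n)) (λ κ → sgn (e κ) * (remove imbalance κ * imbalance κ))
    ≡⟨ adjoint n imbalance imbalance ⟩
  sumOver (partitions n) (λ μ → sgn (e μ) * (imbalance μ * add (suc n) imbalance μ))
    ≡⟨ sumOver-cong (partitions n) (λ {μ} μ∈ → trans
         (cong (λ k → sgn (e μ) * (imbalance μ * k))
           (add-eigen imbalance branching n (∈⇒⊢ μ∈) ℕ.≤-refl))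
         (rearrange (sgn (e μ)) (imbalance μ) (eigenvalue n))) ⟩
  sumOver (partitions n) (λ μ → eigenvalue n * (sgn (e μ) * imbalance μ ^ 2))
    ≡⟨ sumOver-*ˡ (eigenvalue n) (λ μ → sgn (e μ) * imbalance μ ^ 2) (partitions n) ⟩
  eigenvalue n * alternatingSum n ∎
  where
  open ≡-Reasoning
  rearrange : ∀ s i c → s * (i * (c * i)) ≡ c * (s * (i * (i * 1ℤ)))
  rearrange = solve-∀

theorem5p1 : (n : ℕ) → 2 ≤ n →
    sumOver (partitions n) (λ μ → (-1ℤ ^ e μ) * (imbalance μ ^ 2)) ≡ 0ℤ
-- `eigenvalue 1` computes to 0, so the product reduces to 0 whatever the sum at 1 is.
theorem5p1 (suc (suc zero))    _ = alternatingSum-suc 1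
theorem5p1 (suc (suc (suc n))) _ = trans (alternatingSum-suc (suc (suc n)))
  (trans (cong (eigenvalue (suc (suc n)) *_) (theorem5p1 (suc (suc n)) (s≤s (s≤s z≤n))))
         (ℤ.*-zeroʳ (eigenvalue (suc (suc n)))))
theorem5p1 (suc zero) (s≤s ())
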